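{- Let $p$ be an odd prime, $n$ a positive integer, $q=p^n$, and let $f$ be a planar function on $\mathbb F_{q^2}$. Let $\theta\in\mathbb F_{q^2}^*$ be such that $\theta^{q+1}$ is a nonsquare in $\mathbb F_q$, and assume that for every $c\in\mathbb F_{q^2}$, \[\#\{x\in\mathbb F_{q^2}:f(x)=c\}=\#\{y\in\mathbb F_{q^2}:y^2=c\}.\] Then the set $\mathcal U_\theta:=\{(x,t\theta):x\in\mathbb F_{q^2},t\in\mathbb F_q\}\cup\{(\infty)\}$ is a unital in $\Pi(f)$. Furthermore, for such $\theta$, $\mathcal U_\theta$ is a unital in $\Pi(f)$ for each of the following planar functions $f$ on $\mathbb F_{q^2}$: (a) $f(x)=x^2$; (b) $f(x)=x^{p^k+1}$, where $k$ is an integer with $1\le k\le n$ and $2n/\gcd(2n,k)$ odd; (c) $f(x)=x^{(3^k+1)/2}$, where $p=3$ and $\gcd(k,2n)=1$.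
   Context: A function $f:\mathbb F_{q^2}\to\mathbb F_{q^2}$ is planar if for every $a\neq 0$ the map $x\mapsto f(x+a)-f(x)$ is a bijection. For planar $f$, $\Pi(f)$ is the projective plane with points $(x,y)\in\mathbb F_{q^2}^2$ and $(a)$ for $a\in\mathbb F_{q^2}\cup\{\infty\}$, and lines $L_{a,b}=\{(x,f(x+a)-b):x\in\mathbb F_{q^2}\}\cup\{(a)\}$ ($a,b\in\mathbb F_{q^2}$), $N_a=\{(a,y):y\in\mathbb F_{q^2}\}\cup\{(\infty)\}$ ($a\in\mathbb F_{q^2}$), $L_\infty=\{(a):a\in\mathbb F_{q^2}\cup\{\infty\}\}$, incidence being membership. A unital in $\Pi(f)$ is a set of $q^3+1$ points meeting every line in exactly $1$ or $q+1$ points. -}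

module Defs where

open import Level using (Level; _⊔_; suc)
open import Algebra.Bundles using (CommutativeRing)
open import Algebra.Definitions using (Invertible)
open import Algebra.Morphism.Structures using (IsRingMonomorphism)
import Algebra.Properties.Semiring.Exp as Exp
open import Data.Fin.Base using (Fin)
open import Data.Maybe.Base using (Maybe; just; nothing)
import Data.Maybe.Relation.Binary.Pointwise as Maybe
open import Data.Nat.Base as ℕ using (ℕ)
open import Data.Product.Base using (Σ; ∃; ∃₂; _×_; _,_; proj₁)
open import Data.Product.Relation.Binary.Pointwise.NonDependent using (_×ₛ_)
open import Data.Sum.Base using (_⊎_; inj₁; inj₂)
open import Data.Sum.Relation.Binary.Pointwise using (_⊎ₛ_)
open import Function.Bundles using (Func; Inverse)
open import Function.Definitions using (Bijective)
open import Relation.Binary.Bundles using (Setoid)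
import Relation.Binary.Construct.On as On
open import Relation.Binary.PropositionalEquality as ≡ using (_≡_)
open import Relation.Nullary.Negation using (¬_)
open import Relation.Unary using (Pred; _∩_)

private
  variable
    a b c ℓ k κ p r : Level

-- A subset is a predicate; two of its elements are identified when they are
-- equal in S, whatever their membership proofs.
subset : (S : Setoid a b) → Pred (Setoid.Carrier S) p → Setoid (a ⊔ p) b
subset S P = On.setoid {B = Σ (Setoid.Carrier S) P} S proj₁

HasSize : Setoid a b → ℕ → Set (a ⊔ b)
HasSize S m = Inverse S (≡.setoid (Fin m))

SubsetHasSize : (S : Setoid a b) → Pred (Setoid.Carrier S) p → ℕ → Set (a ⊔ b ⊔ p)
SubsetHasSize S P m = HasSize (subset S P) m

SameSize : (S : Setoid a b) →
           Pred (Setoid.Carrier S) p → Pred (Setoid.Carrier S) r → Set (a ⊔ b ⊔ p ⊔ r)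
SameSize S P R = Inverse (subset S P) (subset S R)

record FiniteField (c ℓ : Level) (order : ℕ) : Set (suc (c ⊔ ℓ)) where
  field
    commutativeRing : CommutativeRing c ℓ

  open CommutativeRing commutativeRing public
  open Exp semiring public using (_^_; ^-congˡ)

  field
    1≉0        : ¬ (1# ≈ 0#)
    invertible : ∀ {x} → ¬ (x ≈ 0#) → Invertible _≈_ 1# _*_ x
    hasOrder   : HasSize setoid order

-- For K of order q and L of order q ^ 2, the image of an embedding of K in L
-- is the unique subfield of order q.
record Embedding {s t} (K : FiniteField k κ s) (L : FiniteField c ℓ t)
                 : Set (k ⊔ κ ⊔ c ⊔ ℓ) where
  private
    module K = FiniteField K
    module L = FiniteField L
  field
    ι                  : K.Carrier → L.Carrier
    isRingMonomorphism : IsRingMonomorphism K.rawRing L.rawRing ι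

module _ {order : ℕ} (F : FiniteField c ℓ order) where
  open FiniteField F

  Fun : Set (c ⊔ ℓ)
  Fun = Func setoid setoid

  power : ℕ → Fun
  power d = record { to = _^ d ; cong = ^-congˡ d }

  IsSquare : Carrier → Set (c ⊔ ℓ)
  IsSquare u = ∃ λ s → s ^ 2 ≈ u

  Planar : Fun → Set (c ⊔ ℓ)
  Planar f = ∀ e → ¬ (e ≈ 0#) → Bijective _≈_ _≈_ (λ x → to (x + e) - to x)
    where open Func f

  FibresLikeSquaring : Fun → Set (c ⊔ ℓ)
  FibresLikeSquaring f =
    ∀ v → SameSize setoid (λ x → Func.to f x ≈ v) (λ y → y ^ 2 ≈ v)

  -- Slopes live in Maybe Carrier, with nothing playing the role of ∞.
  Points : Setoid c (c ⊔ ℓ)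
  Points = (setoid ×ₛ setoid) ⊎ₛ Maybe.setoid setoid

  Point : Set c
  Point = Setoid.Carrier Points

  open Setoid Points public using () renaming (_≈_ to _≈ₚ_)

  data Line : Set c where
    L[_,_] : Carrier → Carrier → Line
    N[_]   : Carrier → Line
    L∞     : Line

pattern aff x y = inj₁ (x , y)
pattern dir m   = inj₂ (just m)
pattern dir∞    = inj₂ nothing

module _ {order : ℕ} (F : FiniteField c ℓ order) where
  open FiniteField F

  private
    infix 4 _≋_
    _≋_ : Point F → Point F → Set (c ⊔ ℓ)
    _≋_ = _≈ₚ_ F

  -- The set of points of Π(f) on a given line.
  Π : Fun F → Line F → Pred (Point F) (c ⊔ ℓ)
  Π f L[ m , v ] P = (∃ λ x → P ≋ aff x (Func.to f (x + m) - v)) ⊎ P ≋ dir m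
  Π f N[ m ]     P = (∃ λ y → P ≋ aff m y) ⊎ P ≋ dir∞
  Π f L∞         P = ∃ λ (s : Maybe Carrier) → P ≋ inj₂ s

  record IsUnital (q : ℕ) (f : Fun F) (U : Pred (Point F) p) : Set (c ⊔ ℓ ⊔ p) where
    field
      size  : SubsetHasSize (Points F) U (q ℕ.^ 3 ℕ.+ 1)
      meets : ∀ l → SubsetHasSize (Points F) (U ∩ Π f l) 1
                  ⊎ SubsetHasSize (Points F) (U ∩ Π f l) (q ℕ.+ 1)

module _ {s t : ℕ} {K : FiniteField k κ s} {L : FiniteField c ℓ t}
         (emb : Embedding K L) where
  private
    module K = FiniteField K
    module L = FiniteField L
  open Embedding emb

  NonsquareInSubfield : L.Carrier → Set (k ⊔ κ ⊔ ℓ)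
  NonsquareInSubfield z = ∃ λ u → ι u L.≈ z × ¬ IsSquare K u

  𝒰 : L.Carrier → Pred (Point L) (k ⊔ c ⊔ ℓ)
  𝒰 θ P = (∃₂ λ x t → _≈ₚ_ L P (aff x (ι t L.* θ))) ⊎ _≈ₚ_ L P dir∞

{-# OPTIONS --safe #-}

-- Write q = pⁿ and b = b₀ + b₁ θ with b₀ , b₁ in K, the subfield of order q. Composing with a
-- permutation of L one may replace f by squaring, so the points of the unital on L[ a , b ]
-- correspond to the y = u + v θ with y ² - b in K θ. If θ ² = A + B θ this says u ² + A v ² = b₀,
-- where - A = θ ^ (q + 1) is a nonsquare, so the form is anisotropic: the equation has one
-- solution if b₀ = 0 and q + 1 otherwise.
--
-- For an even power x ^ (2 e) with e odd, planarity alone makes x ^ e such a permutation. The maps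
-- x ^ (p ^ k + 1) are planar since z ^ (p ^ k) = - z forces z = - z when iterated an odd number of
-- times back to the identity. For the Coulter–Matthews exponent d the difference function of x ^ d
-- is, up to scaling, the Dickson polynomial D (d - 1). It permutes L: D r ∘ D m = D (r m), on L
-- the value of D i depends only on i modulo |L| ² - 1, and d - 1 is invertible modulo that number.

module Submission where

open import Defs
open import Level using (Level; _⊔_)
open import Algebra.Bundles using (CommutativeRing; CommutativeMonoid)
open import Algebra.Morphism.Structures using (module RingMorphisms)
import Algebra.Properties.AbelianGroup
import Algebra.Properties.CommutativeMonoid.Sum
import Algebra.Properties.CommutativeSemiring.Binomial
import Algebra.Properties.CommutativeSemiring.Exp
import Algebra.Properties.Ring
import Algebra.Properties.Semiring.Mult
import Algebra.Properties.Semiring.Mult.TCOptimised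
import Algebra.Solver.Ring
open import Algebra.Solver.Ring.AlmostCommutativeRing using (fromCommutativeRing; _-Raw-AlmostCommutative⟶_)
open import Data.Bool.Base using (Bool; true; false)
open import Data.Fin.Base as Fin using (Fin; zero; suc)
open import Data.Fin.Permutation using (Permutation′; _⟨$⟩ʳ_)
import Data.Fin.Properties as Fin
open import Data.Integer.Base as ℤ using (ℤ; +_; -[1+_])
import Data.Integer.Properties as ℤ
open import Data.Maybe.Base using (Maybe; just; nothing)
import Data.Maybe.Relation.Binary.Pointwise as Maybe
open import Data.Nat.Base as ℕ using (ℕ; zero; suc)
open import Data.Nat.Combinatorics using (_C_; nC1≡n; nCk+nC[k+1]≡[n+1]C[k+1]; nCn≡1; k>n⇒nCk≡0)
open import Data.Nat.Coprimality using (Coprime; coprime-Bézout; coprime-divisor; gcd≡1⇒coprime)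
open import Data.Nat.Divisibility using (_∣_; divides; divides-refl; quotient; ∣⇒≤; ∣1⇒≡1; ∣-trans; ∣m+n∣m⇒∣n; m∣m*n; n∣m*n; _∣0; m%n≡0⇒n∣m)
open import Data.Nat.DivMod using (_/_; _%_; m%n<n; m*n/n≡m; m≡m%n+[m/n]*n)
open import Data.Nat.GCD using (gcd; gcd[m,n]∣m; gcd[m,n]∣n; module Bézout)
open import Data.Nat.Primality using (Prime; prime[2]; prime⇒irreducible; euclidsLemma)
import Data.Nat.Properties as ℕ
open import Data.Nat.Solver using (module +-*-Solver)
open import Data.Product.Base using (∃; ∃₂; _×_; _,_; proj₁; proj₂)
open import Data.Product.Function.NonDependent.Setoid using (_×-inverse_)
open import Data.Product.Relation.Binary.Pointwise.NonDependent using (_×ₛ_; ≡×≡⇒≡; ≡⇒≡×≡)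
open import Data.Sum.Base as ⊎ using (_⊎_; inj₁; inj₂; [_,_]′)
open import Data.Sum.Function.Setoid using (_⊎-inverse_)
open import Data.Sum.Relation.Binary.Pointwise as Sum using (_⊎ₛ_; Pointwise-≡↔≡)
open import Data.Vec.Base as Vec using (Vec; []; _∷_)
open import Data.Vec.Functional as Vector using (Vector)
open import Function.Base using (_∘_)
open import Function.Bundles using (Func; Inverse; Bijection)
import Function.Construct.Composition as Compose
import Function.Construct.Identity as Identity
import Function.Construct.Symmetry as Symmetry
open import Function.Definitions using (Injective; StrictlySurjective; Congruent)
open import Function.Properties.Bijection using (Bijection⇒Inverse)
open import Relation.Binary.Bundles using (Setoid)
open import Relation.Binary.Definitions using (tri<; tri≈; tri>)
open import Relation.Binary.PropositionalEquality as ≡ using (_≡_)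
import Relation.Binary.Reasoning.Setoid
open import Relation.Nullary.Decidable using (Dec; yes; no; does; dec-true; dec-false; map′)
open import Relation.Nullary.Negation using (¬_; contradiction)
open import Relation.Unary using (Pred; _∩_)

-- Every abscissa occurs in the unital and membership restricts only the ordinate, so the size of a
-- section by L[ a , b ] depends only on how often f takes each value; this is why a condition on
-- fibres can replace the shape of f. A size is a bijection with an initial segment of ℕ, so each
-- count is an explicit parametrisation, and the conic is parametrised by K with a point at
-- infinity.
--
-- The identity - A = θ ^ (q + 1) holds because θ ^ q is the other root of X ² - B X - A.
--
-- The exponents are twice odd numbers for arithmetic reasons: if 2 n / gcd (2 n , k) is odd, then k
-- is even and p ^ k is 1 modulo 4; if gcd (k , 2 n) = 1, then k is odd and 3 ^ k is 3 modulo 8.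
--
-- Dickson polynomials are usually treated through y with x = y + y⁻¹, which may lie in a quadratic
-- extension of L and satisfies y ^ |L| = y or y⁻¹. No such extension is built here: the alternative
-- appears as a vanishing product of D (|L| - 1) - 2 and D (|L| + 1) - 2, and the other identities
-- come from the recurrence.

private variable
  a b c ℓ ℓ₁ ℓ₂ p : Level
  S T : Setoid a ℓ
  o n N : ℕ


-- Finite setoids

-- A missed `j`, listed before the values of `f`, would give an injection of n + 1 elements into n.
fin-injective⇒surjective : {f : Fin n → Fin n} → Injective _≡_ _≡_ f →
                           StrictlySurjective _≡_ f
fin-injective⇒surjective {n} {f} inj j with Fin.any? (λ i → f i Fin.≟ j)
... | yes hit = hit
... | no miss = contradiction (Fin.injective⇒≤ f⁺-injective) (ℕ.<-irrefl ≡.refl)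
  where
  f⁺ : Fin (suc n) → Fin n
  f⁺ zero    = j
  f⁺ (suc i) = f i
  f⁺-injective : Injective _≡_ _≡_ f⁺
  f⁺-injective {zero}  {zero}  _  = ≡.refl
  f⁺-injective {zero}  {suc i} eq = contradiction (i , ≡.sym eq) miss
  f⁺-injective {suc i} {zero}  eq = contradiction (i , eq) miss
  f⁺-injective {suc i} {suc k} eq = ≡.cong suc (inj eq)

module _ {S : Setoid a ℓ₁} {T : Setoid b ℓ₂} (sizeS : HasSize S n) (sizeT : HasSize T n) where
  private
    module S = Setoid S
    module T = Setoid T
    module IS = Inverse sizeS
    module IT = Inverse sizeT

  index-injective : ∀ {x y} → IT.to x ≡ IT.to y → x T.≈ y
  index-injective {x} {y} eq = T.trans (T.sym (IT.strictlyInverseʳ x))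
    (T.trans (IT.from-cong eq) (IT.strictlyInverseʳ y))

  injective⇒surjective : {f : S.Carrier → T.Carrier} → Injective S._≈_ T._≈_ f →
                         StrictlySurjective T._≈_ f
  injective⇒surjective {f} inj y
    = let i , eq = fin-injective⇒surjective g-injective (IT.to y) in IS.from i , index-injective eq
    where
    g-injective : Injective _≡_ _≡_ (λ i → IT.to (f (IS.from i)))
    g-injective {i} {j} eq = ≡.trans (≡.sym (IS.strictlyInverseˡ i))
      (≡.trans (IS.to-cong (inj (index-injective eq))) (IS.strictlyInverseˡ j))

size-× : HasSize S o → HasSize T n → HasSize (S ×ₛ T) (o ℕ.* n)
size-× sizeS sizeT = Compose.inverse (sizeS ×-inverse sizeT)
  (Compose.inverse ×-≡ (Symmetry.inverse Fin.*↔×))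
  where
  ×-≡ : Inverse (≡.setoid (Fin o) ×ₛ ≡.setoid (Fin n)) (≡.setoid (Fin o × Fin n))
  ×-≡ = record
    { to = λ x → x ; from = λ x → x ; to-cong = ≡×≡⇒≡ ; from-cong = ≡⇒≡×≡
    ; inverse = ≡×≡⇒≡ , ≡⇒≡×≡ }

size-⊎ : HasSize S o → HasSize T n → HasSize (S ⊎ₛ T) (o ℕ.+ n)
size-⊎ sizeS sizeT = Compose.inverse (sizeS ⊎-inverse sizeT)
  (Compose.inverse (Pointwise-≡↔≡ _ _) (Symmetry.inverse Fin.+↔⊎))

size-Maybe : HasSize S o → HasSize (Maybe.setoid S) (o ℕ.+ 1)
size-Maybe {S = S} {o = o} sizeS = ≡.subst (HasSize _) (ℕ.+-comm 1 o) record
  { to        = to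
  ; from      = from
  ; to-cong   = λ { (Maybe.just eq) → ≡.cong suc (I.to-cong eq) ; Maybe.nothing → ≡.refl }
  ; from-cong = λ { ≡.refl → M.refl }
  ; inverse   = (λ { {i} eq → inverseˡ i eq }) , λ { {x} ≡.refl → inverseʳ x }
  }
  where
  module I = Inverse sizeS
  module M = Setoid (Maybe.setoid S)
  to : Maybe (Setoid.Carrier S) → Fin (suc o)
  to (just x) = suc (I.to x)
  to nothing  = zero
  from : Fin (suc o) → Maybe (Setoid.Carrier S)
  from zero    = nothing
  from (suc i) = just (I.from i)
  inverseˡ : ∀ i {x} → x M.≈ from i → to x ≡ i
  inverseˡ zero    Maybe.nothing   = ≡.refl
  inverseˡ (suc i) (Maybe.just eq) = ≡.cong suc (I.inverseˡ eq)
  inverseʳ : ∀ x → from (to x) M.≈ x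
  inverseʳ (just x) = Maybe.just (I.strictlyInverseʳ x)
  inverseʳ nothing  = Maybe.nothing

-- All point counts below go through this: a parametrisation `h` by a setoid already counted takes
-- the place of a decision procedure for `P`.
size-subset : {A : Setoid a ℓ₁} {S : Setoid b ℓ₂} {P : Pred (Setoid.Carrier S) p} →
              let module A = Setoid A; module S = Setoid S in
              HasSize A o → (h : A.Carrier → S.Carrier) → Congruent A._≈_ S._≈_ h →
              (∀ x → P (h x)) → Injective A._≈_ S._≈_ h →
              (∀ {y} → P y → ∃ λ x → h x S.≈ y) → SubsetHasSize S P o
size-subset {A = A} {S} {P} sizeA h h-cong h∈P h-inj h-surj =
  Compose.inverse (Symmetry.inverse (Bijection⇒Inverse bijection)) sizeA
  where
  bijection : Bijection A (subset S P)
  bijection = record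
    { to        = λ x → h x , h∈P x
    ; cong      = h-cong
    ; bijective = h-inj , λ (y , y∈P) → let x , hx≈y = h-surj y∈P in
        x , λ z≈x → Setoid.trans S (h-cong z≈x) hx≈y
    }

-- Commutative rings

-- The solver over ℤ rather than over R itself: integer coefficients can be compared, so that
-- terms cancel.
module IntegerCoefficients {c ℓ} (R : CommutativeRing c ℓ) where
  open CommutativeRing R
  open Algebra.Properties.Ring ring
  open Algebra.Properties.AbelianGroup +-abelianGroup using (⁻¹-∙-comm; ε⁻¹≈ε)
  open Algebra.Properties.Semiring.Mult.TCOptimised semiring using (1+×; ×-homo-+) renaming (_×_ to _⋆_)
  open Relation.Binary.Reasoning.Setoid setoid

  fromℤ : ℤ → Carrier
  fromℤ (+ n)    = n ⋆ 1#
  fromℤ -[1+ n ] = - (suc n ⋆ 1#)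

  fromℤ-⊖ : ∀ m n → fromℤ (m ℤ.⊖ n) ≈ m ⋆ 1# - n ⋆ 1#
  fromℤ-⊖ m       zero    = sym (trans (+-congˡ ε⁻¹≈ε) (+-identityʳ _))
  fromℤ-⊖ zero    (suc n) = sym (+-identityˡ _)
  fromℤ-⊖ (suc m) (suc n) = begin
    fromℤ (suc m ℤ.⊖ suc n)                ≡⟨ ≡.cong fromℤ (ℤ.[1+m]⊖[1+n]≡m⊖n m n) ⟩
    fromℤ (m ℤ.⊖ n)                        ≈⟨ fromℤ-⊖ m n ⟩
    m ⋆ 1# - n ⋆ 1#                        ≈⟨ +-congʳ (+-identityˡ _) ⟨
    (0# + m ⋆ 1#) - n ⋆ 1#                 ≈⟨ +-congʳ (+-congʳ (-‿inverseʳ 1#)) ⟨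
    (1# - 1# + m ⋆ 1#) - n ⋆ 1#            ≈⟨ +-congʳ (+-assoc _ _ _) ⟩
    (1# + (- 1# + m ⋆ 1#)) - n ⋆ 1#        ≈⟨ +-congʳ (+-congˡ (+-comm _ _)) ⟩
    (1# + (m ⋆ 1# - 1#)) - n ⋆ 1#          ≈⟨ +-congʳ (+-assoc _ _ _) ⟨
    (1# + m ⋆ 1# - 1#) - n ⋆ 1#            ≈⟨ +-assoc _ _ _ ⟩
    1# + m ⋆ 1# + (- 1# - n ⋆ 1#)          ≈⟨ +-congˡ (⁻¹-∙-comm _ _) ⟩
    1# + m ⋆ 1# - (1# + n ⋆ 1#)            ≈⟨ +-cong (1+× m 1#) (-‿cong (1+× n 1#)) ⟨
    suc m ⋆ 1# - suc n ⋆ 1#                ∎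

  fromℤ-neg : ∀ i → fromℤ (ℤ.- i) ≈ - fromℤ i
  fromℤ-neg (+ zero)  = sym ε⁻¹≈ε
  fromℤ-neg (+ suc n) = refl
  fromℤ-neg -[1+ n ]  = sym (-‿involutive _)

  fromℤ-+ : ∀ i j → fromℤ (i ℤ.+ j) ≈ fromℤ i + fromℤ j
  fromℤ-+ (+ m)    (+ n)    = ×-homo-+ 1# m n
  fromℤ-+ (+ m)    -[1+ n ] = fromℤ-⊖ m (suc n)
  fromℤ-+ -[1+ m ] (+ n)    = trans (fromℤ-⊖ n (suc m)) (+-comm _ _)
  fromℤ-+ -[1+ m ] -[1+ n ] = begin
    - (suc (suc (m ℕ.+ n)) ⋆ 1#)     ≡⟨ ≡.cong (λ k → - (suc k ⋆ 1#)) (ℕ.+-suc m n) ⟨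
    - ((suc m ℕ.+ suc n) ⋆ 1#)       ≈⟨ -‿cong (×-homo-+ 1# (suc m) (suc n)) ⟩
    - (suc m ⋆ 1# + suc n ⋆ 1#)      ≈⟨ ⁻¹-∙-comm _ _ ⟨
    - (suc m ⋆ 1#) - (suc n ⋆ 1#)    ∎

  fromℤ-*⁺ : ∀ m j → fromℤ (+ m ℤ.* j) ≈ m ⋆ 1# * fromℤ j
  fromℤ-*⁺ zero    j = sym (zeroˡ _)
  fromℤ-*⁺ (suc m) j = begin
    fromℤ (+ suc m ℤ.* j)              ≡⟨ ≡.cong fromℤ (ℤ.suc-* (+ m) j) ⟩
    fromℤ (j ℤ.+ + m ℤ.* j)            ≈⟨ fromℤ-+ j _ ⟩
    fromℤ j + fromℤ (+ m ℤ.* j)        ≈⟨ +-cong (sym (*-identityˡ _)) (fromℤ-*⁺ m j) ⟩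
    1# * fromℤ j + m ⋆ 1# * fromℤ j    ≈⟨ distribʳ _ _ _ ⟨
    (1# + m ⋆ 1#) * fromℤ j            ≈⟨ *-congʳ (1+× m 1#) ⟨
    suc m ⋆ 1# * fromℤ j               ∎

  fromℤ-* : ∀ i j → fromℤ (i ℤ.* j) ≈ fromℤ i * fromℤ j
  fromℤ-* (+ m)    j = fromℤ-*⁺ m j
  fromℤ-* -[1+ m ] j = begin
    fromℤ (-[1+ m ] ℤ.* j)          ≡⟨ ≡.cong fromℤ (ℤ.neg-distribˡ-* (+ suc m) j) ⟨
    fromℤ (ℤ.- (+ suc m ℤ.* j))     ≈⟨ fromℤ-neg (+ suc m ℤ.* j) ⟩
    - fromℤ (+ suc m ℤ.* j)         ≈⟨ -‿cong (fromℤ-*⁺ (suc m) j) ⟩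
    - (suc m ⋆ 1# * fromℤ j)        ≈⟨ -‿distribˡ-* _ _ ⟩
    fromℤ -[1+ m ] * fromℤ j        ∎

  fromℤ-homomorphism : ℤ.+-*-rawRing -Raw-AlmostCommutative⟶ fromCommutativeRing R
  fromℤ-homomorphism = record
    { ⟦_⟧ = fromℤ ; +-homo = fromℤ-+ ; *-homo = fromℤ-* ; -‿homo = fromℤ-neg
    ; 0-homo = refl ; 1-homo = refl }

  private
    _coeff≟_ : ∀ i j → Maybe (fromℤ i ≈ fromℤ j)
    i coeff≟ j with i ℤ.≟ j
    ... | yes eq = just (reflexive (≡.cong fromℤ eq))
    ... | no  _  = nothing

  open Algebra.Solver.Ring ℤ.+-*-rawRing (fromCommutativeRing R) fromℤ-homomorphism _coeff≟_
    public using (solve; _:=_; _:+_; _:*_; _:-_; :-_; _:^_; con; Polynomial)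

  :0 :1 :2 : ∀ {n} → Polynomial n
  :0 = con (+ 0)
  :1 = con (+ 1)
  :2 = con (+ 2)

-- Parity and binomial coefficients modulo a prime

odd⇒suc-double : ∀ n → ¬ 2 ∣ n → ∃ λ k → n ≡ suc (k ℕ.* 2)
odd⇒suc-double n 2∤n with n % 2 in eq | m%n<n n 2 | m≡m%n+[m/n]*n n 2
... | zero        | _                    | _   = contradiction (m%n≡0⇒n∣m n 2 eq) 2∤n
... | suc zero    | _                    | n≡  = n / 2 , n≡
... | suc (suc _) | ℕ.s≤s (ℕ.s≤s ()) | _

-- Absorption, by Pascal's rule used twice: it splits off one copy of `x`, the two induction
-- hypotheses give the remainder a common factor `suc n`, and the other factor is `x` again. The
-- form without division is the one to which Euclid's lemma applies.
[1+k]*[1+n]C[1+k]≡[1+n]*nCk : ∀ n k → suc k ℕ.* (suc n C suc k) ≡ suc n ℕ.* (n C k)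
[1+k]*[1+n]C[1+k]≡[1+n]*nCk zero    zero    = ≡.refl
[1+k]*[1+n]C[1+k]≡[1+n]*nCk zero    (suc k) = ≡.trans
  (≡.cong (suc (suc k) ℕ.*_) (k>n⇒nCk≡0 {1} {suc (suc k)} (ℕ.s≤s (ℕ.s≤s ℕ.z≤n))))
  (≡.trans (ℕ.*-zeroʳ (suc (suc k)))
    (≡.cong (1 ℕ.*_) (≡.sym (k>n⇒nCk≡0 {0} {suc k} (ℕ.s≤s ℕ.z≤n)))))
[1+k]*[1+n]C[1+k]≡[1+n]*nCk (suc n) zero    = ≡.trans (ℕ.*-identityˡ _)
  (≡.trans (nC1≡n (suc (suc n))) (≡.sym (ℕ.*-identityʳ (suc (suc n)))))
[1+k]*[1+n]C[1+k]≡[1+n]*nCk (suc n) (suc k) = begin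
  suc (suc k) ℕ.* (suc (suc n) C suc (suc k))
    ≡⟨ ≡.cong (suc (suc k) ℕ.*_) (nCk+nC[k+1]≡[n+1]C[k+1] (suc n) (suc k)) ⟨
  suc (suc k) ℕ.* (x ℕ.+ (suc n C suc (suc k)))
    ≡⟨ ℕ.*-distribˡ-+ (suc (suc k)) x _ ⟩
  x ℕ.+ suc k ℕ.* x ℕ.+ suc (suc k) ℕ.* (suc n C suc (suc k))
    ≡⟨ ≡.cong₂ (λ u v → x ℕ.+ u ℕ.+ v) ([1+k]*[1+n]C[1+k]≡[1+n]*nCk n k) ([1+k]*[1+n]C[1+k]≡[1+n]*nCk n (suc k)) ⟩
  x ℕ.+ suc n ℕ.* (n C k) ℕ.+ suc n ℕ.* (n C suc k)
    ≡⟨ ℕ.+-assoc x _ _ ⟩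
  x ℕ.+ (suc n ℕ.* (n C k) ℕ.+ suc n ℕ.* (n C suc k))
    ≡⟨ ≡.cong (x ℕ.+_) (ℕ.*-distribˡ-+ (suc n) (n C k) (n C suc k)) ⟨
  x ℕ.+ suc n ℕ.* ((n C k) ℕ.+ (n C suc k))
    ≡⟨ ≡.cong (λ u → x ℕ.+ suc n ℕ.* u) (nCk+nC[k+1]≡[n+1]C[k+1] n k) ⟩
  suc (suc n) ℕ.* x ∎
  where
  open ≡.≡-Reasoning
  x = suc n C suc k

-- By absorption the prime divides the product of `suc k` and the coefficient, and `suc k` is too
-- small to be the factor divided.
prime⇒∣C : Prime (suc n) → ∀ {k} → k ℕ.< n → suc n ∣ suc n C suc k
prime⇒∣C {n} isPrime {k} k<n with euclidsLemma (suc k) (suc n C suc k) isPrime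
  (divides (n C k) (≡.trans ([1+k]*[1+n]C[1+k]≡[1+n]*nCk n k) (ℕ.*-comm (suc n) (n C k))))
... | inj₁ p∣k = contradiction (ℕ.s≤s k<n) (ℕ.≤⇒≯ (∣⇒≤ p∣k))
... | inj₂ p∣C = p∣C

module _ (M : CommutativeMonoid c ℓ) where
  open CommutativeMonoid M
  open Algebra.Properties.CommutativeMonoid.Sum M using (sum)

  sum-ε : (t : Vector Carrier n) → (∀ j → t j ≈ ε) → sum t ≈ ε
  sum-ε {zero}  t t≈ε = refl
  sum-ε {suc n} t t≈ε = trans (∙-cong (t≈ε zero) (sum-ε (t ∘ suc) (t≈ε ∘ suc))) (identityˡ ε)

  -- For a general monoid, since it serves additively in the binomial expansion of the Frobenius map
  -- and multiplicatively in `fermat`.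
  sum-single : (t : Vector Carrier n) (i : Fin n) → (∀ j → ¬ j ≡ i → t j ≈ ε) → sum t ≈ t i
  sum-single t zero    t≈ε = trans (∙-congˡ (sum-ε (t ∘ suc) (λ j → t≈ε (suc j) (λ ())))) (identityʳ _)
  sum-single t (suc i) t≈ε = trans (∙-cong (t≈ε zero (λ ()))
    (sum-single (t ∘ suc) i (λ j j≢i → t≈ε (suc j) (j≢i ∘ Fin.suc-injective)))) (identityˡ _)

-- The Frobenius map and the number of roots of a polynomial

module CommutativeRingProperties (R : CommutativeRing c ℓ) where
  open CommutativeRing R hiding (zero)
  open Algebra.Properties.CommutativeSemiring.Exp commutativeSemiring
  open Algebra.Properties.Semiring.Mult semiring using (×-assocˡ; ×-assoc-*; ×-congʳ) renaming (_×_ to _⋆_)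
  open Algebra.Properties.AbelianGroup +-abelianGroup using (x≈y⇒x∙y⁻¹≈ε; x∙y⁻¹≈ε⇒x≈y)
  open IntegerCoefficients R
  open Relation.Binary.Reasoning.Setoid setoid

  0^ : ∀ n → 1 ℕ.≤ n → 0# ^ n ≈ 0#
  0^ (suc n) _ = zeroˡ _

  ^-suc-comm : ∀ x n → x ^ (n ℕ.+ 1) ≈ x ^ n * x
  ^-suc-comm x n = trans (^-homo-* x n 1) (*-congˡ (*-identityʳ x))

  ⋆-annihilates : ∀ p → p ⋆ 1# ≈ 0# → ∀ {n} → p ∣ n → ∀ x → n ⋆ x ≈ 0#
  ⋆-annihilates p p⋆1≈0 (divides-refl k) x = begin
    (k ℕ.* p) ⋆ x       ≈⟨ ×-assocˡ x k p ⟨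
    k ⋆ (p ⋆ x)         ≈⟨ ×-congʳ k (×-congʳ p (*-identityˡ x)) ⟨
    k ⋆ (p ⋆ (1# * x))  ≈⟨ ×-congʳ k (×-assoc-* p 1# x) ⟨
    k ⋆ (p ⋆ 1# * x)    ≈⟨ ×-congʳ k (*-congʳ p⋆1≈0) ⟩
    k ⋆ (0# * x)        ≈⟨ ×-congʳ k (zeroˡ x) ⟩
    k ⋆ 0#              ≈⟨ ×-congʳ k (zeroʳ 0#) ⟨
    k ⋆ (0# * 0#)       ≈⟨ ×-assoc-* k 0# 0# ⟨
    k ⋆ 0# * 0#         ≈⟨ zeroʳ _ ⟩
    0#                  ∎

  module Frobenius (p : ℕ) (isPrime : Prime p) (p⋆1≈0 : p ⋆ 1# ≈ 0#) where
    open Algebra.Properties.CommutativeSemiring.Binomial commutativeSemiring using (theorem; binomialTerm)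
    open Algebra.Properties.CommutativeMonoid.Sum +-commutativeMonoid using (sum)

    frobenius-+ : ∀ x y → (x + y) ^ p ≈ x ^ p + y ^ p
    frobenius-+ x y = aux p isPrime p⋆1≈0
      where
      aux : ∀ p → Prime p → p ⋆ 1# ≈ 0# → (x + y) ^ p ≈ x ^ p + y ^ p
      aux (suc n) isPrime p⋆1≈0 = begin
        (x + y) ^ suc n                   ≈⟨ theorem (suc n) x y ⟩
        t zero + sum (t ∘ suc)            ≈⟨ +-congˡ (sum-single +-commutativeMonoid (t ∘ suc) (Fin.fromℕ n) vanish) ⟩
        t zero + t (suc (Fin.fromℕ n))    ≈⟨ +-cong first last ⟩
        y ^ suc n + x ^ suc n             ≈⟨ +-comm _ _ ⟩
        x ^ suc n + y ^ suc n             ∎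
        where
        t = binomialTerm x y (suc n)
        vanish : ∀ j → ¬ j ≡ Fin.fromℕ n → t (suc j) ≈ 0#
        vanish j j≢n = ⋆-annihilates (suc n) p⋆1≈0
          (prime⇒∣C isPrime (ℕ.≤∧≢⇒< (Fin.toℕ≤pred[n] j) (λ eq → j≢n (Fin.toℕ-injective (≡.trans eq (≡.sym (Fin.toℕ-fromℕ n)))))))
          _
        first : t zero ≈ y ^ suc n
        first = trans (+-identityʳ _) (*-identityˡ _)
        last : t (suc (Fin.fromℕ n)) ≈ x ^ suc n
        last rewrite Fin.toℕ-fromℕ n | nCn≡1 (suc n) | ℕ.n∸n≡0 n = trans (+-identityʳ _) (*-identityʳ _)

    frobenius^-+ : ∀ j x y → (x + y) ^ (p ℕ.^ j) ≈ x ^ (p ℕ.^ j) + y ^ (p ℕ.^ j)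
    frobenius^-+ zero    x y = trans (*-identityʳ _) (sym (+-cong (*-identityʳ x) (*-identityʳ y)))
    frobenius^-+ (suc j) x y = begin
      (x + y) ^ (p ℕ.* q)               ≈⟨ ^-assocʳ (x + y) p q ⟨
      ((x + y) ^ p) ^ q                 ≈⟨ ^-congˡ q (frobenius-+ x y) ⟩
      (x ^ p + y ^ p) ^ q               ≈⟨ frobenius^-+ j (x ^ p) (y ^ p) ⟩
      (x ^ p) ^ q + (y ^ p) ^ q         ≈⟨ +-cong (^-assocʳ x p q) (^-assocʳ y p q) ⟩
      x ^ (p ℕ.* q) + y ^ (p ℕ.* q)     ∎
      where q = p ℕ.^ j

  -- The value at x of the monic polynomial of degree n with lower coefficients cs, constant term first.
  monic : Vec Carrier n → Carrier → Carrier
  monic []       x = 1#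
  monic (c ∷ cs) x = c + x * monic cs x

  -- Horner's scheme for the quotient by x - `a`: each coefficient is a tail of the polynomial
  -- evaluated at `a`. The leading coefficient 1 stays implicit, so the last entry simply
  -- disappears.
  deflate : Vec Carrier (suc n) → Carrier → Vec Carrier n
  deflate (c ∷ [])         a = []
  deflate (c ∷ cs@(_ ∷ _)) a = monic cs a ∷ deflate cs a

  monic-deflate : (cs : Vec Carrier (suc n)) → ∀ a x →
                   monic cs x ≈ monic cs a + (x - a) * monic (deflate cs a) x
  monic-deflate (c ∷ []) a x =
    solve 3 (λ c a x → c :+ x :* :1 := c :+ a :* :1 :+ (x :- a) :* :1) refl c a x
  monic-deflate (c ∷ cs@(_ ∷ _)) a x = begin
    c + x * monic cs x
      ≈⟨ +-congˡ (*-congˡ (monic-deflate cs a x)) ⟩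
    c + x * (monic cs a + (x - a) * monic (deflate cs a) x)
      ≈⟨ solve 5 (λ c x u a w → c :+ x :* (u :+ (x :- a) :* w) :=
           c :+ a :* u :+ (x :- a) :* (u :+ x :* w)) refl _ _ _ _ _ ⟩
    c + a * monic cs a + (x - a) * (monic cs a + x * monic (deflate cs a) x) ∎

  module Domain (1≉0 : ¬ 1# ≈ 0#) (integral : ∀ {x y} → x * y ≈ 0# → x ≈ 0# ⊎ y ≈ 0#) where
    ^≈0⇒≈0 : ∀ {x} n → x ^ n ≈ 0# → x ≈ 0#
    ^≈0⇒≈0 zero    1≈0 = contradiction 1≈0 1≉0
    ^≈0⇒≈0 (suc n) eq with integral eq
    ... | inj₁ x≈0 = x≈0
    ... | inj₂ eq′ = ^≈0⇒≈0 n eq′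

    -- Dividing by the factor of one root lowers the degree and keeps the other roots, until the
    -- constant 1 is left with a root.
    monic-roots : (cs : Vec Carrier n) (root : Fin (suc n) → Carrier) → Injective _≡_ _≈_ root →
                  ¬ (∀ i → monic cs (root i) ≈ 0#)
    monic-roots []             root inj vanish = 1≉0 (vanish zero)
    monic-roots cs@(_ ∷ _)     root inj vanish =
      monic-roots (deflate cs (root zero)) (root ∘ suc) (Fin.suc-injective ∘ inj) vanish′
      where
      vanish′ : ∀ i → monic (deflate cs (root zero)) (root (suc i)) ≈ 0#
      vanish′ i with integral (begin
        (root (suc i) - root zero) * monic (deflate cs (root zero)) (root (suc i))
          ≈⟨ +-identityˡ _ ⟨
        0# + (root (suc i) - root zero) * monic (deflate cs (root zero)) (root (suc i))
          ≈⟨ +-congʳ (vanish zero) ⟨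
        monic cs (root zero) + (root (suc i) - root zero) * monic (deflate cs (root zero)) (root (suc i))
          ≈⟨ monic-deflate cs (root zero) (root (suc i)) ⟨
        monic cs (root (suc i))
          ≈⟨ vanish (suc i) ⟩
        0# ∎)
      ... | inj₁ eq = contradiction (inj (x∙y⁻¹≈ε⇒x≈y _ _ eq)) (λ ())
      ... | inj₂ eq = eq

    monic-0s : ∀ n x → monic (Vec.replicate n 0#) x ≈ x ^ n
    monic-0s zero    x = refl
    monic-0s (suc n) x = trans (+-identityˡ _) (*-congˡ (monic-0s n x))

    -- x ^ q - x is monic of degree q.
    fixedPoints-^ : ∀ {q} → 2 ℕ.≤ q → (fix : Fin (suc q) → Carrier) → Injective _≡_ _≈_ fix →
                    ¬ (∀ i → fix i ^ q ≈ fix i)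
    fixedPoints-^ {suc (suc q)} (ℕ.s≤s (ℕ.s≤s _)) fix inj fixed =
      monic-roots (0# ∷ - 1# ∷ Vec.replicate q 0#) fix inj λ i → let x = fix i in begin
        0# + x * (- 1# + x * monic (Vec.replicate q 0#) x)
          ≈⟨ +-congˡ (*-congˡ (+-congˡ (*-congˡ (monic-0s q x)))) ⟩
        0# + x * (- 1# + x * x ^ q)
          ≈⟨ solve 2 (λ x u → :0 :+ x :* (:- :1 :+ x :* u) := x :* (x :* u) :- x) refl _ _ ⟩
        x ^ suc (suc q) - x
          ≈⟨ x≈y⇒x∙y⁻¹≈ε (fixed i) ⟩
        0# ∎

-- Finite fields: characteristic and Fermat's theorem

module _ (F : FiniteField c ℓ N) where
  open FiniteField F

  OddCharacteristic : Set ℓ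
  OddCharacteristic = ¬ 1# + 1# ≈ 0#

  Anisotropic : Carrier → Set (c ⊔ ℓ)
  Anisotropic A = ∀ u v → u * u + A * (v * v) ≈ 0# → u ≈ 0# × v ≈ 0#

module FiniteFieldProperties {N} (F : FiniteField c ℓ N) where
  open FiniteField F hiding (zero)
  open CommutativeRingProperties commutativeRing public
  open Algebra.Properties.CommutativeSemiring.Exp commutativeSemiring public
    using (^-homo-*; ^-assocʳ; ^-distrib-*; ^-congʳ)
  open Algebra.Properties.Semiring.Mult semiring public using (×1-homo-*) renaming (_×_ to _⋆_)
  open IntegerCoefficients commutativeRing public
  open Algebra.Properties.AbelianGroup +-abelianGroup public
    using (x≈y⇒x∙y⁻¹≈ε; x∙y⁻¹≈ε⇒x≈y; inverseˡ-unique; identityʳ-unique)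
  open Inverse hasOrder public using () renaming (to to index; from to element; to-cong to index-cong;
    strictlyInverseʳ to element-index; strictlyInverseˡ to index-element)
  open Relation.Binary.Reasoning.Setoid setoid

  infix 4 _≟_
  _≟_ : ∀ x y → Dec (x ≈ y)
  x ≟ y = map′ (index-injective hasOrder hasOrder) index-cong (index x Fin.≟ index y)

  infix 8 _⁻¹⟨_⟩
  _⁻¹⟨_⟩ : ∀ x → ¬ x ≈ 0# → Carrier
  x ⁻¹⟨ x≉0 ⟩ = proj₁ (invertible x≉0)

  *-inverseˡ : ∀ {x} (x≉0 : ¬ x ≈ 0#) → x ⁻¹⟨ x≉0 ⟩ * x ≈ 1#
  *-inverseˡ x≉0 = proj₁ (proj₂ (invertible x≉0))

  *-inverseʳ : ∀ {x} (x≉0 : ¬ x ≈ 0#) → x * x ⁻¹⟨ x≉0 ⟩ ≈ 1#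
  *-inverseʳ x≉0 = proj₂ (proj₂ (invertible x≉0))

  *-cancelˡ : ∀ {x y z} → ¬ x ≈ 0# → x * y ≈ x * z → y ≈ z
  *-cancelˡ {x} {y} {z} x≉0 eq = begin
    y                     ≈⟨ *-identityˡ y ⟨
    1# * y                ≈⟨ *-congʳ (*-inverseˡ x≉0) ⟨
    x ⁻¹⟨ x≉0 ⟩ * x * y   ≈⟨ *-assoc _ _ _ ⟩
    x ⁻¹⟨ x≉0 ⟩ * (x * y) ≈⟨ *-congˡ eq ⟩
    x ⁻¹⟨ x≉0 ⟩ * (x * z) ≈⟨ *-assoc _ _ _ ⟨
    x ⁻¹⟨ x≉0 ⟩ * x * z   ≈⟨ *-congʳ (*-inverseˡ x≉0) ⟩
    1# * z                ≈⟨ *-identityˡ z ⟩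
    z                     ∎

  integral : ∀ {x y} → x * y ≈ 0# → x ≈ 0# ⊎ y ≈ 0#
  integral {x} {y} xy≈0 with x ≟ 0#
  ... | yes x≈0 = inj₁ x≈0
  ... | no  x≉0 = inj₂ (*-cancelˡ x≉0 (trans xy≈0 (sym (zeroʳ x))))

  open Domain 1≉0 integral public

  *-≉0 : ∀ {x y} → ¬ x ≈ 0# → ¬ y ≈ 0# → ¬ x * y ≈ 0#
  *-≉0 x≉0 y≉0 xy≈0 = [ x≉0 , y≉0 ]′ (integral xy≈0)

  private
    permutation : Inverse setoid setoid → Permutation′ N
    permutation π = Compose.inverse (Symmetry.inverse hasOrder) (Compose.inverse π hasOrder)

  -- Translation by 1 permutes the field, so adding 1 to each of the N elements leaves their sum
  -- unchanged.
  N⋆1≈0 : N ⋆ 1# ≈ 0#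
  N⋆1≈0 = identityʳ-unique (sum element) (N ⋆ 1#) (begin
    sum element + N ⋆ 1#                        ≈⟨ +-congˡ (sum-replicate N) ⟨
    sum element + sum (Vector.replicate N 1#)   ≈⟨ ∑-distrib-+ element _ ⟨
    sum (λ i → element i + 1#)                  ≈⟨ sum-cong-≋ {N} (λ i → element-index (element i + 1#)) ⟨
    sum (λ i → element (permutation shift ⟨$⟩ʳ i)) ≈⟨ sum-permute element (permutation shift) ⟨
    sum element                                 ∎)
    where
    open Algebra.Properties.CommutativeMonoid.Sum +-commutativeMonoid
    shift : Inverse setoid setoid
    shift = record
      { to = _+ 1# ; from = _- 1# ; to-cong = +-congʳ ; from-cong = +-congʳ
      ; inverse = (λ eq → trans (+-congʳ eq) (solve 1 (λ x → x :- :1 :+ :1 := x) refl _))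
                , (λ eq → trans (+-congʳ eq) (solve 1 (λ x → x :+ :1 :- :1 := x) refl _)) }

  -- The characteristic is read off from the order: p ^ j vanishes in the field, which has no zero
  -- divisors.
  p⋆1≈0 : ∀ {p} j → N ≡ p ℕ.^ j → p ⋆ 1# ≈ 0#
  p⋆1≈0 {p} j ≡.refl = descend j N⋆1≈0
    where
    descend : ∀ j → (p ℕ.^ j) ⋆ 1# ≈ 0# → p ⋆ 1# ≈ 0#
    descend zero    eq = contradiction (trans (sym (+-identityʳ 1#)) eq) 1≉0
    descend (suc j) eq with integral (trans (sym (×1-homo-* p (p ℕ.^ j))) eq)
    ... | inj₁ p≈0 = p≈0
    ... | inj₂ eq′ = descend j eq′

  -- For nonzero `z`, multiplication by `z` permutes the nonzero elements; comparing their product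
  -- before and after shows that N - 1 factors `z` multiply to 1.
  fermat : ∀ x → x ^ N ≈ x
  fermat z with z ≟ 0#
  ... | yes z≈0 = trans (^-congˡ N z≈0) (trans (0^ N (ℕ.≤-trans (ℕ.s≤s ℕ.z≤n) (Fin.toℕ<n (index 0#)))) (sym z≈0))
  ... | no z≉0 = begin
    z ^ N                            ≈⟨ sum-replicate N ⟨
    prod (Vector.replicate N z)      ≈⟨ sum-cong-≋ (λ i → kδ (element i ≟ 0#)) ⟨
    prod (λ i → k (element i) * δ (element i))           ≈⟨ ∑-distrib-+ (k ∘ element) (δ ∘ element) ⟩
    prod (k ∘ element) * prod (δ ∘ element)              ≈⟨ *-cong prod-k prod-δ ⟩
    1# * z                           ≈⟨ *-identityˡ z ⟩
    z                                ∎
    where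
    open Algebra.Properties.CommutativeMonoid.Sum *-commutativeMonoid renaming (sum to prod)
    onZero : ∀ {x} → Dec (x ≈ 0#) → Carrier → Carrier → Carrier
    onZero (yes _) u v = u
    onZero (no _)  u v = v
    -- The products range over all N elements, so 0 is patched by hand: `h` replaces it by 1, `k`
    -- contributes one factor `z` for each nonzero element, and `δ` supplies the remaining factor
    -- `z` at 0.
    h k δ : Carrier → Carrier
    h x = onZero (x ≟ 0#) 1# x
    k x = onZero (x ≟ 0#) 1# z
    δ x = onZero (x ≟ 0#) z 1#
    kδ : ∀ {x} (d : Dec (x ≈ 0#)) → onZero d 1# z * onZero d z 1# ≈ z
    kδ (yes _) = *-identityˡ z
    kδ (no  _) = *-identityʳ z
    h-scale : ∀ {x y} → y ≈ z * x → (d : Dec (x ≈ 0#)) (e : Dec (y ≈ 0#)) →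
              onZero e 1# y ≈ onZero d 1# x * onZero d 1# z
    h-scale y≈zx (yes x≈0) (yes y≈0) = sym (*-identityˡ 1#)
    h-scale y≈zx (yes x≈0) (no  y≉0) = contradiction (trans y≈zx (trans (*-congˡ x≈0) (zeroʳ z))) y≉0
    h-scale y≈zx (no  x≉0) (yes y≈0) = contradiction (trans (sym y≈zx) y≈0) (*-≉0 z≉0 x≉0)
    h-scale y≈zx (no  x≉0) (no  y≉0) = trans y≈zx (*-comm _ _)
    h≉0 : ∀ {x} (d : Dec (x ≈ 0#)) → ¬ onZero d 1# x ≈ 0#
    h≉0 (yes _)  = 1≉0
    h≉0 (no x≉0) = x≉0
    prod≉0 : ∀ {n} (t : Vector Carrier n) → (∀ i → ¬ t i ≈ 0#) → ¬ prod t ≈ 0#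
    prod≉0 {zero}  t t≉0 = 1≉0
    prod≉0 {suc n} t t≉0 = *-≉0 (t≉0 zero) (prod≉0 (t ∘ suc) (t≉0 ∘ suc))
    prod-δ : prod (δ ∘ element) ≈ z
    prod-δ = trans (sum-single *-commutativeMonoid (δ ∘ element) (index 0#)
        λ j j≢0 → away (element j ≟ 0#) λ eq → j≢0 (≡.trans (≡.sym (index-element j)) (index-cong eq)))
      (at (element (index 0#) ≟ 0#) (element-index 0#))
      where
      away : ∀ {x} (d : Dec (x ≈ 0#)) → ¬ x ≈ 0# → onZero d z 1# ≈ 1#
      away (yes x≈0) x≉0 = contradiction x≈0 x≉0
      away (no _)    _   = refl
      at : ∀ {x} (d : Dec (x ≈ 0#)) → x ≈ 0# → onZero d z 1# ≈ z
      at (yes _)  _   = refl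
      at (no x≉0) x≈0 = contradiction x≈0 x≉0
    scale : Inverse setoid setoid
    scale = record
      { to = z *_ ; from = z ⁻¹⟨ z≉0 ⟩ *_ ; to-cong = *-congˡ ; from-cong = *-congˡ
      ; inverse = (λ eq → trans (*-congˡ eq) (trans (sym (*-assoc _ _ _)) (trans (*-congʳ (*-inverseʳ z≉0)) (*-identityˡ _))))
                , (λ eq → trans (*-congˡ eq) (trans (sym (*-assoc _ _ _)) (trans (*-congʳ (*-inverseˡ z≉0)) (*-identityˡ _)))) }
    prod-k : prod (k ∘ element) ≈ 1#
    prod-k = *-cancelˡ (prod≉0 (h ∘ element) (λ i → h≉0 (element i ≟ 0#))) (begin
      prod (h ∘ element) * prod (k ∘ element)           ≈⟨ ∑-distrib-+ (h ∘ element) (k ∘ element) ⟨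
      prod (λ i → h (element i) * k (element i))        ≈⟨ sum-cong-≋ (λ i → h-scale (element-index _) (element i ≟ 0#) (_ ≟ 0#)) ⟨
      prod (λ i → h (element (permutation scale ⟨$⟩ʳ i))) ≈⟨ sum-permute (h ∘ element) (permutation scale) ⟨
      prod (h ∘ element)                                ≈⟨ *-identityʳ _ ⟨
      prod (h ∘ element) * 1#                           ∎)

  2≤order : 2 ℕ.≤ N
  2≤order = Fin.injective⇒≤ {f = λ { zero → index 0# ; (suc _) → index 1# }} λ
    { {zero} {zero} _ → ≡.refl
    ; {zero} {suc zero} eq → contradiction (sym (index-injective hasOrder hasOrder eq)) 1≉0
    ; {suc zero} {zero} eq → contradiction (index-injective hasOrder hasOrder eq) 1≉0
    ; {suc zero} {suc zero} _ → ≡.refl }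

  odd⇒2≉0 : ∀ {p} → ¬ 2 ∣ p → p ⋆ 1# ≈ 0# → OddCharacteristic F
  odd⇒2≉0 {p} 2∤p p⋆1≈0 2≈0 with k , ≡.refl ← odd⇒suc-double p 2∤p = 1≉0 (begin
    1#                        ≈⟨ +-identityʳ 1# ⟨
    1# + 0#                   ≈⟨ +-congˡ (⋆-annihilates 2 (trans (+-congˡ (+-identityʳ 1#)) 2≈0) (divides-refl k) 1#) ⟨
    suc (k ℕ.* 2) ⋆ 1#        ≈⟨ p⋆1≈0 ⟩
    0#                        ∎)

  fermat^ : ∀ j x → x ^ (N ℕ.^ j) ≈ x
  fermat^ zero    x = *-identityʳ x
  fermat^ (suc j) x = begin
    x ^ (N ℕ.* N ℕ.^ j)  ≈⟨ ^-assocʳ x N (N ℕ.^ j) ⟨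
    (x ^ N) ^ (N ℕ.^ j)  ≈⟨ ^-congˡ (N ℕ.^ j) (fermat x) ⟩
    x ^ (N ℕ.^ j)        ≈⟨ fermat^ j x ⟩
    x                    ∎

-- Conics of anisotropic binary forms

does-<?-irrefl : (i : Fin n) → does (i Fin.<? i) ≡ false
does-<?-irrefl i = dec-false (i Fin.<? i) (ℕ.<-irrefl ≡.refl)

does-<?-sym⇒≡ : (i j : Fin n) → does (i Fin.<? j) ≡ does (j Fin.<? i) → i ≡ j
does-<?-sym⇒≡ i j eq with Fin.<-cmp i j
... | tri≈ _ i≡j _     = i≡j
... | tri< i<j _ j≮i   = contradiction
  (≡.trans (≡.sym (dec-true (i Fin.<? j) i<j)) (≡.trans eq (dec-false (j Fin.<? i) j≮i))) λ ()
... | tri> i≮j _ j<i   = contradiction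
  (≡.trans (≡.sym (dec-true (j Fin.<? i) j<i)) (≡.trans (≡.sym eq) (dec-false (i Fin.<? j) i≮j))) λ ()

module Conic {q} (F : FiniteField c ℓ q) (2≉0 : OddCharacteristic F)
             (A : FiniteField.Carrier F) (anisotropic : Anisotropic F A) where
  open FiniteField F hiding (zero)
  open FiniteFieldProperties F
  open Relation.Binary.Reasoning.Setoid setoid

  norm : Carrier → Carrier → Carrier
  norm u v = u * u + A * (v * v)

  norm-cong : ∀ {u v u′ v′} → u ≈ u′ → v ≈ v′ → norm u v ≈ norm u′ v′
  norm-cong u≈u′ v≈v′ = +-cong (*-cong u≈u′ u≈u′) (*-congˡ (*-cong v≈v′ v≈v′))

  A≉0 : ¬ A ≈ 0#
  A≉0 A≈0 = 1≉0 (proj₂ (anisotropic 0# 1# (trans (+-congˡ (*-congʳ A≈0))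
    (solve 0 (:0 :* :0 :+ :0 :* (:1 :* :1) := :0) refl))))

  -- An arbitrary choice between u and - u, taken from the enumeration. Together with the square it
  -- determines u, and at 0 it is `false`.
  sign : Carrier → Bool
  sign u = does (index u Fin.<? index (- u))

  sign-cong : ∀ {u v} → u ≈ v → sign u ≡ sign v
  sign-cong u≈v = ≡.cong₂ (λ i j → does (i Fin.<? j)) (index-cong u≈v) (index-cong (-‿cong u≈v))

  square-sign-injective : ∀ {u v} → u * u ≈ v * v → sign u ≡ sign v → u ≈ v
  square-sign-injective {u} {v} u²≈v² same = [ (λ v-u≈0 → sym (x∙y⁻¹≈ε⇒x≈y v u v-u≈0)) , opposite ]′ (integral (begin
      (v - u) * (v + u)  ≈⟨ solve 2 (λ u v → (v :- u) :* (v :+ u) := v :* v :- u :* u) refl u v ⟩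
      v * v - u * u      ≈⟨ x≈y⇒x∙y⁻¹≈ε (sym u²≈v²) ⟩
      0#                 ∎))
    where
    opposite : v + u ≈ 0# → u ≈ v
    opposite v+u≈0 = trans (index-injective hasOrder hasOrder u≡-u) (sym v≈-u)
      where
      v≈-u = inverseˡ-unique v u v+u≈0
      u≡-u : index u ≡ index (- u)
      u≡-u = does-<?-sym⇒≡ _ _ (≡.trans same (≡.cong₂ (λ i j → does (i Fin.<? j)) (index-cong v≈-u)
        (index-cong (trans (-‿cong v≈-u) (solve 1 (λ u → :- (:- u) := u) refl u)))))

  -- Pigeonhole: if the values of u ² and c - A v ² were disjoint, recording in addition a sign
  -- would inject K ⊎ K into K × Bool and hence hit (c , true).
  norm-surjective : ∀ c → ∃₂ λ u v → norm u v ≈ c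
  norm-surjective c with Fin.any? (λ i → Fin.any? (λ j → norm (element i) (element j) ≟ c))
  ... | yes (i , j , eq) = element i , element j , eq
  -- The pair (c , true) is chosen because the second family takes the value c only at v = 0, where
  -- the sign is `false`; so c must be a square, contrary to its being missed or not, a solution
  -- results.
  ... | no none = hit (injective⇒surjective size₁ size₂ g-injective (c , true))
    where
    missed : ∀ u v → ¬ norm u v ≈ c
    missed u v eq = none (index u , index v , trans (norm-cong (element-index u) (element-index v)) eq)
    source = setoid ⊎ₛ setoid
    target = setoid ×ₛ ≡.setoid Bool
    module T = Setoid target
    g : Setoid.Carrier source → Setoid.Carrier target
    g (inj₁ u) = u * u , sign u
    g (inj₂ v) = c - A * (v * v) , sign v
    size₁ : HasSize source (q ℕ.+ q)
    size₁ = size-⊎ hasOrder hasOrder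
    size₂ : HasSize target (q ℕ.+ q)
    size₂ = ≡.subst (HasSize target)
      (≡.trans (ℕ.*-comm q 2) (≡.cong (q ℕ.+_) (ℕ.+-identityʳ q)))
      (size-× hasOrder (Symmetry.inverse Fin.2↔Bool))
    g-injective : Injective (Setoid._≈_ source) T._≈_ g
    g-injective {inj₁ u} {inj₁ v} (eq , s) = Sum.inj₁ (square-sign-injective eq s)
    g-injective {inj₁ u} {inj₂ v} (eq , s) = contradiction
      (trans (+-congʳ eq) (solve 2 (λ c a → c :- a :+ a := c) refl _ _)) (missed u v)
    g-injective {inj₂ u} {inj₁ v} (eq , s) = contradiction
      (trans (+-congʳ (sym eq)) (solve 2 (λ c a → c :- a :+ a := c) refl _ _)) (missed v u)
    g-injective {inj₂ u} {inj₂ v} (eq , s) = Sum.inj₂ (square-sign-injective (*-cancelˡ A≉0 (begin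
      A * (u * u)            ≈⟨ solve 2 (λ c a → a := c :- (c :- a)) refl c _ ⟩
      c - (c - A * (u * u))  ≈⟨ +-congˡ (-‿cong eq) ⟩
      c - (c - A * (v * v))  ≈⟨ solve 2 (λ c a → c :- (c :- a) := a) refl c _ ⟩
      A * (v * v)            ∎)) s)
    hit : (∃ λ x → g x T.≈ (c , true)) → ∃₂ λ u v → norm u v ≈ c
    hit (inj₁ u , eq , _) = u , 0# ,
      trans (solve 2 (λ u a → u :* u :+ a :* (:0 :* :0) := u :* u) refl u A) eq
    hit (inj₂ v , eq , s) = contradiction (≡.trans (≡.sym s) (≡.trans (sign-cong v≈0) sign-0)) λ ()
      where
      Av²≈0 : A * (v * v) ≈ 0#
      Av²≈0 = trans (solve 2 (λ c a → a := c :- (c :- a)) refl c _) (x≈y⇒x∙y⁻¹≈ε (sym eq))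
      v≈0 : v ≈ 0#
      v≈0 = proj₂ (anisotropic 0# v (trans (+-congʳ (zeroˡ 0#)) (trans (+-identityˡ _) Av²≈0)))
      sign-0 : sign 0# ≡ false
      sign-0 = ≡.trans (≡.cong (λ i → does (index 0# Fin.<? i)) (index-cong (solve 0 (:- :0 := :0) refl)))
        (does-<?-irrefl (index 0#))

  -- The line of slope t through (-1, 0) meets u ² + A v ² = 1 again in
  -- ((1 - A t ²) / (1 + A t ²), 2 t / (1 + A t ²)); multiplication by u₀ + v₀ √-A carries this
  -- parametrisation to the conic through (u₀ , v₀).
  module Parametrisation (u₀ v₀ : Carrier) (c≉0 : ¬ norm u₀ v₀ ≈ 0#) where
    private
      c₀ = norm u₀ v₀

    Dt≉0 : ∀ t → ¬ 1# + A * (t * t) ≈ 0#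
    Dt≉0 t eq = 1≉0 (proj₁ (anisotropic 1# t (trans (+-congʳ (*-identityˡ 1#)) eq)))

    d : Carrier → Carrier
    d t = (1# + A * (t * t)) ⁻¹⟨ Dt≉0 t ⟩

    Dd≈1 : ∀ t → (1# + A * (t * t)) * d t ≈ 1#
    Dd≈1 t = *-inverseʳ (Dt≉0 t)

    d-cong : ∀ {t s} → t ≈ s → d t ≈ d s
    d-cong {t} {s} t≈s = *-cancelˡ (Dt≉0 t) (begin
      (1# + A * (t * t)) * d t  ≈⟨ Dd≈1 t ⟩
      1#                        ≈⟨ Dd≈1 s ⟨
      (1# + A * (s * s)) * d s  ≈⟨ *-congʳ (+-congˡ (*-congˡ (*-cong t≈s t≈s))) ⟨
      (1# + A * (t * t)) * d s  ∎)

    -- `nothing` is the slope ∞, the tangent at (-1, 0): it yields the base point of the pencil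
    -- itself, carried to (- u₀ , - v₀).
    conicPoint : Maybe Carrier → Carrier × Carrier
    conicPoint (just t) =
      ((1# - A * (t * t)) * u₀ - (1# + 1#) * t * A * v₀) * d t ,
      ((1# - A * (t * t)) * v₀ + (1# + 1#) * t * u₀) * d t
    conicPoint nothing  = - u₀ , - v₀

    private
      module M = Setoid (Maybe.setoid setoid)
      module P = Setoid (setoid ×ₛ setoid)

    conicPoint-cong : Congruent M._≈_ P._≈_ conicPoint
    conicPoint-cong (Maybe.just t≈s) =
      let Att = *-congˡ (*-cong t≈s t≈s) in
      *-cong (+-cong (*-congʳ (+-congˡ (-‿cong Att))) (-‿cong (*-congʳ (*-congʳ (*-congˡ t≈s))))) (d-cong t≈s) ,
      *-cong (+-cong (*-congʳ (+-congˡ (-‿cong Att))) (*-congʳ (*-congˡ t≈s))) (d-cong t≈s)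
    conicPoint-cong Maybe.nothing = P.refl

    norm-conicPoint : ∀ t → let u , v = conicPoint t in norm u v ≈ c₀
    norm-conicPoint (just t) = begin
      norm (proj₁ (conicPoint (just t))) (proj₂ (conicPoint (just t)))
        ≈⟨ solve 5 (λ A t d u₀ v₀ →
             let u = ((:1 :- A :* (t :* t)) :* u₀ :- :2 :* t :* A :* v₀) :* d
                 v = ((:1 :- A :* (t :* t)) :* v₀ :+ :2 :* t :* u₀) :* d
             in u :* u :+ A :* (v :* v) :=
                ((:1 :+ A :* (t :* t)) :* d) :* ((:1 :+ A :* (t :* t)) :* d) :* (u₀ :* u₀ :+ A :* (v₀ :* v₀)))
             refl A t (d t) u₀ v₀ ⟩
      ((1# + A * (t * t)) * d t) * ((1# + A * (t * t)) * d t) * c₀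
        ≈⟨ *-congʳ (*-cong (Dd≈1 t) (Dd≈1 t)) ⟩
      1# * 1# * c₀
        ≈⟨ solve 1 (λ c → :1 :* :1 :* c := c) refl c₀ ⟩
      c₀ ∎
    norm-conicPoint nothing =
      solve 3 (λ u v A → :- u :* :- u :+ A :* (:- v :* :- v) := u :* u :+ A :* (v :* v)) refl u₀ v₀ A

    -- The parameter is recovered as Z / W, and W vanishes at nothing.
    W Z : Carrier × Carrier → Carrier
    W (u , v) = u * u₀ + A * (v * v₀) + c₀
    Z (u , v) = v * u₀ - u * v₀

    W-cong : ∀ {x y} → x P.≈ y → W x ≈ W y
    W-cong (u≈ , v≈) = +-congʳ (+-cong (*-congʳ u≈) (*-congˡ (*-congʳ v≈)))

    Z-cong : ∀ {x y} → x P.≈ y → Z x ≈ Z y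
    Z-cong (u≈ , v≈) = +-cong (*-congʳ v≈) (-‿cong (*-congʳ u≈))

    -- `W` - c₀ and `Z` are the coordinates of (u + v √-A) (u₀ - v₀ √-A). Multiplying by u₀ + v₀ √-A
    -- returns the point scaled by c₀, which is nonzero.
    WZ-injective : ∀ {x y} → W x ≈ W y → Z x ≈ Z y → x P.≈ y
    WZ-injective {x@(u , v)} {y@(u′ , v′)} W≈ Z≈ =
      *-cancelˡ c≉0 (trans (recover-u x) (trans (+-cong (*-congʳ (+-congʳ W≈)) (-‿cong (*-congʳ (*-congˡ Z≈)))) (sym (recover-u y)))) ,
      *-cancelˡ c≉0 (trans (recover-v x) (trans (+-cong (*-congʳ (+-congʳ W≈)) (*-congʳ Z≈)) (sym (recover-v y))))
      where
      recover-u : ∀ x → c₀ * proj₁ x ≈ (W x - c₀) * u₀ - A * Z x * v₀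
      recover-u (u , v) = solve 5 (λ A u₀ v₀ u v →
        let c = u₀ :* u₀ :+ A :* (v₀ :* v₀) in
        c :* u := (u :* u₀ :+ A :* (v :* v₀) :+ c :- c) :* u₀ :- A :* (v :* u₀ :- u :* v₀) :* v₀) refl A u₀ v₀ u v
      recover-v : ∀ x → c₀ * proj₂ x ≈ (W x - c₀) * v₀ + Z x * u₀
      recover-v (u , v) = solve 5 (λ A u₀ v₀ u v →
        let c = u₀ :* u₀ :+ A :* (v₀ :* v₀) in
        c :* v := (u :* u₀ :+ A :* (v :* v₀) :+ c :- c) :* v₀ :+ (v :* u₀ :- u :* v₀) :* u₀) refl A u₀ v₀ u v

    W-conicPoint : ∀ t → W (conicPoint (just t)) ≈ (1# + 1#) * d t * c₀
    W-conicPoint t = begin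
      W (conicPoint (just t))
        ≈⟨ solve 5 (λ A t d u₀ v₀ →
             let u = ((:1 :- A :* (t :* t)) :* u₀ :- :2 :* t :* A :* v₀) :* d
                 v = ((:1 :- A :* (t :* t)) :* v₀ :+ :2 :* t :* u₀) :* d
                 c = u₀ :* u₀ :+ A :* (v₀ :* v₀)
             in u :* u₀ :+ A :* (v :* v₀) :+ c := ((:1 :- A :* (t :* t)) :* d :+ :1) :* c)
             refl A t (d t) u₀ v₀ ⟩
      ((1# - A * (t * t)) * d t + 1#) * c₀
        ≈⟨ *-congʳ (+-congˡ (Dd≈1 t)) ⟨
      ((1# - A * (t * t)) * d t + (1# + A * (t * t)) * d t) * c₀
        ≈⟨ *-congʳ (solve 2 (λ a d → (:1 :- a) :* d :+ (:1 :+ a) :* d := :2 :* d) refl _ _) ⟩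
      (1# + 1#) * d t * c₀ ∎

    Z-conicPoint : ∀ t → Z (conicPoint (just t)) ≈ t * W (conicPoint (just t))
    Z-conicPoint t = begin
      Z (conicPoint (just t))
        ≈⟨ solve 5 (λ A t d u₀ v₀ →
             let u = ((:1 :- A :* (t :* t)) :* u₀ :- :2 :* t :* A :* v₀) :* d
                 v = ((:1 :- A :* (t :* t)) :* v₀ :+ :2 :* t :* u₀) :* d
                 c = u₀ :* u₀ :+ A :* (v₀ :* v₀)
             in v :* u₀ :- u :* v₀ := t :* (:2 :* d :* c))
             refl A t (d t) u₀ v₀ ⟩
      t * ((1# + 1#) * d t * c₀)
        ≈⟨ *-congˡ (W-conicPoint t) ⟨
      t * W (conicPoint (just t)) ∎

    W-conicPoint≉0 : ∀ t → ¬ W (conicPoint (just t)) ≈ 0#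
    W-conicPoint≉0 t eq = *-≉0 (*-≉0 2≉0 d≉0) c≉0 (trans (sym (W-conicPoint t)) eq)
      where
      d≉0 : ¬ d t ≈ 0#
      d≉0 d≈0 = 1≉0 (trans (sym (Dd≈1 t)) (trans (*-congˡ d≈0) (zeroʳ _)))

    W-nothing : W (conicPoint nothing) ≈ 0#
    W-nothing = solve 3 (λ u v A → :- u :* u :+ A :* (:- v :* v) :+ (u :* u :+ A :* (v :* v)) := :0) refl u₀ v₀ A

    conicPoint-injective : Injective M._≈_ P._≈_ conicPoint
    conicPoint-injective {just t}  {just s}  eq = Maybe.just (*-cancelˡ (W-conicPoint≉0 t) (begin
      W (conicPoint (just t)) * t  ≈⟨ *-comm _ _ ⟩
      t * W (conicPoint (just t))  ≈⟨ Z-conicPoint t ⟨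
      Z (conicPoint (just t))      ≈⟨ Z-cong {conicPoint (just t)} {conicPoint (just s)} eq ⟩
      Z (conicPoint (just s))      ≈⟨ Z-conicPoint s ⟩
      s * W (conicPoint (just s))  ≈⟨ *-congˡ (W-cong {conicPoint (just t)} {conicPoint (just s)} eq) ⟨
      s * W (conicPoint (just t))  ≈⟨ *-comm _ _ ⟩
      W (conicPoint (just t)) * s  ∎))
    conicPoint-injective {just t}  {nothing} eq =
      contradiction (trans (W-cong {conicPoint (just t)} {conicPoint nothing} eq) W-nothing) (W-conicPoint≉0 t)
    conicPoint-injective {nothing} {just s}  eq =
      contradiction (trans (sym (W-cong {conicPoint nothing} {conicPoint (just s)} eq)) W-nothing) (W-conicPoint≉0 s)
    conicPoint-injective {nothing} {nothing} eq = Maybe.nothing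

    conicPoint-surjective : ∀ {x} → norm (proj₁ x) (proj₂ x) ≈ c₀ → ∃ λ t → conicPoint t P.≈ x
    conicPoint-surjective {x@(u , v)} on with W x ≟ 0#
    -- On the conic the norm of (u + u₀ , v + v₀) is 2 `W`, so here anisotropy makes the point the
    -- antipode of (u₀ , v₀).
    ... | yes W≈0 = nothing , sym (inverseˡ-unique u u₀ (proj₁ both)) , sym (inverseˡ-unique v v₀ (proj₂ both))
      where
      both = anisotropic (u + u₀) (v + v₀) (begin
        norm (u + u₀) (v + v₀)
          ≈⟨ solve 5 (λ u v u₀ v₀ A →
               (u :+ u₀) :* (u :+ u₀) :+ A :* ((v :+ v₀) :* (v :+ v₀)) :=
               (u :* u :+ A :* (v :* v)) :+ (u₀ :* u₀ :+ A :* (v₀ :* v₀)) :+ :2 :* (u :* u₀ :+ A :* (v :* v₀)))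
               refl u v u₀ v₀ A ⟩
        norm u v + c₀ + (1# + 1#) * (u * u₀ + A * (v * v₀))
          ≈⟨ +-congʳ (+-congʳ on) ⟩
        c₀ + c₀ + (1# + 1#) * (u * u₀ + A * (v * v₀))
          ≈⟨ solve 2 (λ c w → c :+ c :+ :2 :* w := :2 :* (w :+ c)) refl c₀ _ ⟩
        (1# + 1#) * W x
          ≈⟨ trans (*-congˡ W≈0) (zeroʳ _) ⟩
        0# ∎)
    ... | no W≉0 = just t , WZ-injective {conicPoint (just t)} {x} W≈
                     (trans (Z-conicPoint t) (trans (*-congˡ W≈) (sym Z≈tW)))
      where
      w = W x ⁻¹⟨ W≉0 ⟩
      t = Z x * w
      Z≈tW : Z x ≈ t * W x
      Z≈tW = sym (trans (*-assoc _ _ _) (trans (*-congˡ (*-inverseˡ W≉0)) (*-identityʳ _)))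
      -- Multiplicativity of the norm gives W ² + A Z ² = 2 c₀ W on the conic; with Z = t W one
      -- factor W cancels.
      DW≈2c : (1# + A * (t * t)) * W x ≈ (1# + 1#) * c₀
      DW≈2c = *-cancelˡ W≉0 (begin
        W x * ((1# + A * (t * t)) * W x)
          ≈⟨ solve 3 (λ W A t → W :* ((:1 :+ A :* (t :* t)) :* W) := W :* W :+ A :* ((t :* W) :* (t :* W))) refl (W x) A t ⟩
        norm (W x) (t * W x)
          ≈⟨ norm-cong refl Z≈tW ⟨
        norm (W x) (Z x)
          ≈⟨ solve 5 (λ A u₀ v₀ u v →
               let c = u₀ :* u₀ :+ A :* (v₀ :* v₀)
                   W = u :* u₀ :+ A :* (v :* v₀) :+ c
                   Z = v :* u₀ :- u :* v₀
               in W :* W :+ A :* (Z :* Z) := c :* ((u :* u :+ A :* (v :* v)) :+ :2 :* (u :* u₀ :+ A :* (v :* v₀)) :+ c))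
               refl A u₀ v₀ u v ⟩
        c₀ * (norm u v + (1# + 1#) * (u * u₀ + A * (v * v₀)) + c₀)
          ≈⟨ *-congˡ (+-congʳ (+-congʳ on)) ⟩
        c₀ * (c₀ + (1# + 1#) * (u * u₀ + A * (v * v₀)) + c₀)
          ≈⟨ solve 2 (λ c w → c :* (c :+ :2 :* w :+ c) := (w :+ c) :* (:2 :* c)) refl c₀ _ ⟩
        W x * ((1# + 1#) * c₀) ∎)
      W≈ : W (conicPoint (just t)) ≈ W x
      W≈ = begin
        W (conicPoint (just t))         ≈⟨ W-conicPoint t ⟩
        (1# + 1#) * d t * c₀            ≈⟨ solve 2 (λ d c → :2 :* d :* c := d :* (:2 :* c)) refl _ _ ⟩
        d t * ((1# + 1#) * c₀)          ≈⟨ *-congˡ DW≈2c ⟨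
        d t * ((1# + A * (t * t)) * W x) ≈⟨ solve 3 (λ d D W → d :* (D :* W) := D :* d :* W) refl _ _ _ ⟩
        (1# + A * (t * t)) * d t * W x  ≈⟨ *-congʳ (Dd≈1 t) ⟩
        1# * W x                        ≈⟨ *-identityˡ _ ⟩
        W x                             ∎

  OnConic : Carrier → Carrier × Carrier → Set ℓ
  OnConic c (u , v) = norm u v ≈ c

  conic-size : ∀ c → SubsetHasSize (setoid ×ₛ setoid) (OnConic c) 1
                   ⊎ SubsetHasSize (setoid ×ₛ setoid) (OnConic c) (q ℕ.+ 1)
  conic-size c with c ≟ 0#
  ... | yes c≈0 = inj₁ (size-subset {A = ≡.setoid (Fin 1)} (Identity.inverse _) (λ _ → 0# , 0#) (λ _ → refl , refl)
      (λ _ → trans (solve 1 (λ A → :0 :* :0 :+ A :* (:0 :* :0) := :0) refl A) (sym c≈0))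
      (λ { {zero} {zero} _ → ≡.refl })
      λ {(u , v)} on → let u≈0 , v≈0 = anisotropic u v (trans on c≈0) in zero , sym u≈0 , sym v≈0)
  ... | no c≉0 with u₀ , v₀ , on₀ ← norm-surjective c =
    inj₂ (size-subset {A = Maybe.setoid setoid} (size-Maybe hasOrder) conicPoint conicPoint-cong
      (λ t → trans (norm-conicPoint t) on₀) conicPoint-injective
      (λ on → conicPoint-surjective (trans on (sym on₀))))
    where open Parametrisation u₀ v₀ (λ eq → c≉0 (trans (sym on₀) eq))

-- The unital

-- Representatives of v are chosen by their index, so that G is compatible with _≈_ although the
-- given bijections of fibres are unrelated for different v.
module _ (F : FiniteField c ℓ N) (f : Fun F) where
  open FiniteField F
  open FiniteFieldProperties F
  open Func f renaming (to to f⟨_⟩; cong to f-cong)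

  IsSquareOf : Inverse setoid setoid → Set (c ⊔ ℓ)
  IsSquareOf G = ∀ x → f⟨ x ⟩ ≈ Inverse.to G x * Inverse.to G x

  fibresLikeSquaring⇒square : FibresLikeSquaring F f → ∃ IsSquareOf
  fibresLikeSquaring⇒square fibres =
    record
      { to        = G
      ; from      = H
      ; to-cong   = λ x≈y → to-match (index-cong (f-cong x≈y)) _ _ x≈y
      ; from-cong = λ x≈y → from-match (index-cong (^-congˡ 2 x≈y)) _ _ x≈y
      ; inverse   = (λ {x} {y} y≈Hx → trans
                      (to-match (index-of (trans (f-cong y≈Hx) (proj₂ (from-fibre x)))) _ _ y≈Hx)
                      (I.strictlyInverseˡ _ _))
                  , (λ {x} {y} y≈Gx → trans
                      (from-match (index-of (trans (^-congˡ 2 y≈Gx) (proj₂ (to-fibre x)))) _ _ y≈Gx)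
                      (I.strictlyInverseʳ _ _))
      }
    , λ x → trans (trans (sym (element-index _)) (sym (proj₂ (to-fibre x)))) (*-congˡ (*-identityʳ _))
    where
    module I i = Inverse (fibres (element i))
    to-fibre : ∀ x → ∃ λ y → y ^ 2 ≈ element (index f⟨ x ⟩)
    to-fibre x = I.to (index f⟨ x ⟩) (x , sym (element-index _))
    from-fibre : ∀ y → ∃ λ x → f⟨ x ⟩ ≈ element (index (y ^ 2))
    from-fibre y = I.from (index (y ^ 2)) (y , sym (element-index _))
    G H : Carrier → Carrier
    G x = proj₁ (to-fibre x)
    H y = proj₁ (from-fibre y)
    to-match : ∀ {i j} → i ≡ j → ∀ {x y} (p : f⟨ x ⟩ ≈ element i) (r : f⟨ y ⟩ ≈ element j) →
               x ≈ y → proj₁ (I.to i (x , p)) ≈ proj₁ (I.to j (y , r))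
    to-match {i} ≡.refl p r = I.to-cong i
    from-match : ∀ {i j} → i ≡ j → ∀ {x y} (p : x ^ 2 ≈ element i) (r : y ^ 2 ≈ element j) →
                 x ≈ y → proj₁ (I.from i (x , p)) ≈ proj₁ (I.from j (y , r))
    from-match {i} ≡.refl p r = I.from-cong i
    index-of : ∀ {x i} → x ≈ element i → index x ≡ i
    index-of {i = i} x≈ = ≡.trans (index-cong x≈) (index-element i)

-- Coordinates of L over K in the basis 1, θ

module QuadraticExtension (p n : ℕ) (isPrime : Prime p) (2∤p : ¬ 2 ∣ p)
         (K : FiniteField a b (p ℕ.^ n)) (L : FiniteField c ℓ ((p ℕ.^ n) ℕ.^ 2)) (emb : Embedding K L) where
  private
    q = p ℕ.^ n
    module K where
      open FiniteField K public hiding (zero)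
      open FiniteFieldProperties K public
    module L where
      open FiniteField L public hiding (zero)
      open FiniteFieldProperties L public
    open Embedding emb
    open RingMorphisms K.rawRing L.rawRing
    open IsRingMonomorphism isRingMonomorphism
      renaming (⟦⟧-cong to ι-cong; injective to ι-injective; +-homo to ι-+; *-homo to ι-*; -‿homo to ι-neg;
                0#-homo to ι-0; 1#-homo to ι-1)
  open FiniteField L using (setoid; _≈_; _+_; _*_; -_; _-_; _^_; 0#; 1#; refl; sym; trans; +-cong; +-congˡ; +-congʳ; *-cong; *-congˡ; *-congʳ)
  open L using (solve; _:=_; _:+_; _:*_; _:-_; :-_; :2)
  open Relation.Binary.Reasoning.Setoid setoid

  ι-^ : ∀ s d → ι (s K.^ d) ≈ ι s ^ d
  ι-^ s zero    = ι-1
  ι-^ s (suc d) = trans (ι-* s _) (*-congˡ (ι-^ s d))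

  ι-fixed : ∀ s → ι s ^ q ≈ ι s
  ι-fixed s = trans (sym (ι-^ s q)) (ι-cong (K.fermat s))

  p≈0 : p L.⋆ 1# ≈ 0#
  p≈0 = L.p⋆1≈0 (n ℕ.* 2) (ℕ.^-*-assoc p n 2)

  2≉0 : OddCharacteristic K
  2≉0 = K.odd⇒2≉0 2∤p (K.p⋆1≈0 n ≡.refl)

  open L.Frobenius p isPrime p≈0

  module _ (θ : L.Carrier) (nonsquare : NonsquareInSubfield emb (θ ^ (q ℕ.+ 1))) where
    private
      norm-θ = proj₁ nonsquare
      ι-norm-θ : ι norm-θ ≈ θ ^ (q ℕ.+ 1)
      ι-norm-θ = proj₁ (proj₂ nonsquare)
      norm-θ-nonsquare = proj₂ (proj₂ nonsquare)

    -- On K the power s ^ (q + 1) is s ², so an element of K would have a square as its norm.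
    θ∉K : ∀ s → ¬ ι s ≈ θ
    θ∉K s ιs≈θ = norm-θ-nonsquare (s , ι-injective (begin
      ι (s K.^ 2)            ≈⟨ ι-^ s 2 ⟩
      ι s * (ι s * 1#)       ≈⟨ *-cong (ι-fixed s) refl ⟨
      ι s ^ q * ι s ^ 1      ≈⟨ L.^-homo-* (ι s) q 1 ⟨
      ι s ^ (q ℕ.+ 1)        ≈⟨ L.^-congˡ (q ℕ.+ 1) ιs≈θ ⟩
      θ ^ (q ℕ.+ 1)          ≈⟨ ι-norm-θ ⟨
      ι norm-θ               ∎))

    combine : K.Carrier → K.Carrier → L.Carrier
    combine u v = ι u + ι v * θ

    combine-cong : ∀ {u v u′ v′} → u K.≈ u′ → v K.≈ v′ → combine u v ≈ combine u′ v′
    combine-cong u≈ v≈ = +-cong (ι-cong u≈) (*-congʳ (ι-cong v≈))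

    -- If v and v′ differed, the equation could be solved for θ inside K.
    combine-injective : ∀ {u v u′ v′} → combine u v ≈ combine u′ v′ → u K.≈ u′ × v K.≈ v′
    combine-injective {u} {v} {u′} {v′} eq with (v K.- v′) K.≟ K.0#
    ... | yes v-v′≈0 = ι-injective (begin
        ι u                                ≈⟨ solve 2 (λ x y → x := x :+ y :- y) refl _ _ ⟩
        combine u v - ι v * θ              ≈⟨ +-cong eq (L.-‿cong (*-congʳ (ι-cong v≈v′))) ⟩
        combine u′ v′ - ι v′ * θ           ≈⟨ solve 2 (λ x y → x :+ y :- y := x) refl _ _ ⟩
        ι u′                               ∎) , v≈v′
      where v≈v′ = K.x∙y⁻¹≈ε⇒x≈y v v′ v-v′≈0
    ... | no w≉0 = contradiction (begin
        ι (w⁻¹ K.* (u′ K.- u))             ≈⟨ ι-* _ _ ⟩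
        ι w⁻¹ * ι (u′ K.- u)               ≈⟨ *-congˡ (trans (ι-+ u′ _) (+-congˡ (ι-neg u))) ⟩
        ι w⁻¹ * (ι u′ - ι u)               ≈⟨ *-congˡ (solve 4 (λ x x′ y y′ → x′ :- x := (x′ :+ y′) :- x :- y′) refl _ _ (ι v * θ) (ι v′ * θ)) ⟩
        ι w⁻¹ * (combine u′ v′ - ι u - ι v′ * θ)   ≈⟨ *-congˡ (+-congʳ (+-congʳ eq)) ⟨
        ι w⁻¹ * (combine u v - ι u - ι v′ * θ)     ≈⟨ *-congˡ (solve 4 (λ x v v′ t → x :+ v :* t :- x :- v′ :* t := (v :- v′) :* t) refl _ _ _ _) ⟩
        ι w⁻¹ * ((ι v - ι v′) * θ)         ≈⟨ *-congˡ (*-congʳ (trans (ι-+ v _) (+-congˡ (ι-neg v′)))) ⟨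
        ι w⁻¹ * (ι (v K.- v′) * θ)         ≈⟨ L.*-assoc _ _ _ ⟨
        ι w⁻¹ * ι (v K.- v′) * θ           ≈⟨ *-congʳ (ι-* _ _) ⟨
        ι (w⁻¹ K.* (v K.- v′)) * θ         ≈⟨ *-congʳ (trans (ι-cong (K.*-inverseˡ w≉0)) ι-1) ⟩
        1# * θ                             ≈⟨ L.*-identityˡ θ ⟩
        θ                                  ∎) (θ∉K _)
      where w⁻¹ = (v K.- v′) K.⁻¹⟨ w≉0 ⟩

    abstract
      -- Counting replaces a dimension argument: both K × K and L have q ² elements.
      combine-surjective : ∀ z → ∃₂ λ u v → combine u v ≈ z
      combine-surjective z =
        let (u , v) , eq = injective⇒surjective {S = K.setoid ×ₛ K.setoid} {T = setoid}
              (≡.subst (HasSize _) (≡.cong (q ℕ.*_) (≡.sym (ℕ.*-identityʳ q))) (size-× K.hasOrder K.hasOrder))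
              L.hasOrder {f = λ (u , v) → combine u v} combine-injective z
        in u , v , eq

    A B : K.Carrier
    A = proj₁ (combine-surjective (θ * θ))
    B = proj₁ (proj₂ (combine-surjective (θ * θ)))

    θ²≈A+Bθ : θ * θ ≈ combine A B
    θ²≈A+Bθ = sym (proj₂ (proj₂ (combine-surjective (θ * θ))))

    -- The q elements of K already exhaust the roots of x ^ q - x, and θ would be one more.
    θ-moved : ¬ θ ^ q ≈ θ
    θ-moved θ-fixed = L.fixedPoints-^ K.2≤order fix fix-injective
        λ { zero → θ-fixed ; (suc i) → ι-fixed (K.element i) }
      where
      fix : Fin (suc q) → L.Carrier
      fix zero    = θ
      fix (suc i) = ι (K.element i)
      fix-injective : Injective _≡_ _≈_ fix
      fix-injective {zero}  {zero}  _  = ≡.refl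
      fix-injective {zero}  {suc j} eq = contradiction (sym eq) (θ∉K _)
      fix-injective {suc i} {zero}  eq = contradiction eq (θ∉K _)
      fix-injective {suc i} {suc j} eq = ≡.cong suc (≡.trans (≡.sym (K.index-element i))
        (≡.trans (K.index-cong (ι-injective eq)) (K.index-element j)))

    -- θ ^ q is the second root of X ² - B X - A.
    θ^q≈B-θ : θ ^ q ≈ ι B - θ
    θ^q≈B-θ = [ (λ eq → contradiction (L.x∙y⁻¹≈ε⇒x≈y _ _ eq) θ-moved) , L.x∙y⁻¹≈ε⇒x≈y _ _ ]′ (L.integral vanishing)
      where
      conjugate : θ ^ q * θ ^ q ≈ ι A + ι B * θ ^ q
      conjugate = begin
        θ ^ q * θ ^ q                ≈⟨ L.^-distrib-* θ θ q ⟨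
        (θ * θ) ^ q                  ≈⟨ L.^-congˡ q θ²≈A+Bθ ⟩
        combine A B ^ q              ≈⟨ frobenius^-+ n _ _ ⟩
        ι A ^ q + (ι B * θ) ^ q      ≈⟨ +-cong (ι-fixed A) (L.^-distrib-* (ι B) θ q) ⟩
        ι A + ι B ^ q * θ ^ q        ≈⟨ +-congˡ (*-congʳ (ι-fixed B)) ⟩
        ι A + ι B * θ ^ q            ∎
      vanishing : (θ ^ q - θ) * (θ ^ q - (ι B - θ)) ≈ 0#
      vanishing = begin
        (θ ^ q - θ) * (θ ^ q - (ι B - θ))
          ≈⟨ solve 4 (λ X t a b → (X :- t) :* (X :- (b :- t)) :=
               (X :* X :- (a :+ b :* X)) :- (t :* t :- (a :+ b :* t))) refl (θ ^ q) θ (ι A) (ι B) ⟩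
        (θ ^ q * θ ^ q - (ι A + ι B * θ ^ q)) - (θ * θ - combine A B)
          ≈⟨ +-cong (L.x≈y⇒x∙y⁻¹≈ε conjugate) (L.-‿cong (L.x≈y⇒x∙y⁻¹≈ε θ²≈A+Bθ)) ⟩
        0# - 0#
          ≈⟨ L.-‿inverseʳ 0# ⟩
        0# ∎

    norm-θ≈-A : norm-θ K.≈ K.- A
    norm-θ≈-A = ι-injective (begin
      ι norm-θ                         ≈⟨ ι-norm-θ ⟩
      θ ^ (q ℕ.+ 1)                    ≈⟨ L.^-suc-comm θ q ⟩
      θ ^ q * θ                        ≈⟨ *-congʳ θ^q≈B-θ ⟩
      (ι B - θ) * θ                    ≈⟨ solve 2 (λ b t → (b :- t) :* t := b :* t :- t :* t) refl _ _ ⟩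
      ι B * θ - θ * θ                  ≈⟨ +-congˡ (L.-‿cong θ²≈A+Bθ) ⟩
      ι B * θ - combine A B            ≈⟨ solve 2 (λ a b → b :- (a :+ b) := :- a) refl _ _ ⟩
      - ι A                            ≈⟨ ι-neg A ⟨
      ι (K.- A)                        ∎)

    -- With v nonzero, an isotropic vector would give (u / v) ² = - A, the nonsquare norm of θ.
    anisotropic : Anisotropic K A
    anisotropic u v eq with v K.≟ K.0#
    ... | yes v≈0 = [ (λ x → x) , (λ x → x) ]′ (K.integral (K.trans (K.sym (K.+-identityʳ _))
            (K.trans (K.+-congˡ (K.sym (K.trans (K.*-congˡ (K.trans (K.*-congˡ v≈0) (K.zeroʳ v))) (K.zeroʳ A)))) eq))) , v≈0
    ... | no v≉0 = contradiction (u K.* w , root) norm-θ-nonsquare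
      where
      module KR = Relation.Binary.Reasoning.Setoid K.setoid
      w = v K.⁻¹⟨ v≉0 ⟩
      root : (u K.* w) K.^ 2 K.≈ norm-θ
      root = KR.begin
        (u K.* w) K.^ 2
          KR.≈⟨ K.solve 4 (λ A u v w → (u K.:* w) K.:* ((u K.:* w) K.:* K.:1) K.:=
                  (u K.:* u K.:+ A K.:* (v K.:* v)) K.:* (w K.:* w) K.:- A K.:* ((v K.:* w) K.:* (v K.:* w))) K.refl A u v w ⟩
        (u K.* u K.+ A K.* (v K.* v)) K.* (w K.* w) K.- A K.* ((v K.* w) K.* (v K.* w))
          KR.≈⟨ K.+-cong (K.*-congʳ eq) (K.-‿cong (K.*-congˡ (K.*-cong (K.*-inverseʳ v≉0) (K.*-inverseʳ v≉0)))) ⟩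
        K.0# K.* (w K.* w) K.- A K.* (K.1# K.* K.1#)
          KR.≈⟨ K.solve 2 (λ A x → K.:0 K.:* x K.:- A K.:* (K.:1 K.:* K.:1) K.:= K.:- A) K.refl A _ ⟩
        K.- A
          KR.≈⟨ norm-θ≈-A ⟨
        norm-θ KR.∎

    open Conic K 2≉0 A anisotropic

    -- The part B θ of θ ² only affects the second coordinate. Membership in K θ is decided by the
    -- first one, which is therefore a diagonal form.
    combine-square : ∀ u v → combine u v * combine u v ≈
                     combine (norm u v) ((K.1# K.+ K.1#) K.* (u K.* v) K.+ B K.* (v K.* v))
    combine-square u v = begin
      combine u v * combine u v
        ≈⟨ solve 3 (λ u v t → (u :+ v :* t) :* (u :+ v :* t) :=
             u :* u :+ :2 :* (u :* v) :* t :+ v :* v :* (t :* t)) refl _ _ _ ⟩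
      ι u * ι u + (1# + 1#) * (ι u * ι v) * θ + ι v * ι v * (θ * θ)
        ≈⟨ +-congˡ (*-congˡ θ²≈A+Bθ) ⟩
      ι u * ι u + (1# + 1#) * (ι u * ι v) * θ + ι v * ι v * combine A B
        ≈⟨ solve 5 (λ u v t A B → u :* u :+ :2 :* (u :* v) :* t :+ v :* v :* (A :+ B :* t) :=
             u :* u :+ A :* (v :* v) :+ (:2 :* (u :* v) :+ B :* (v :* v)) :* t) refl _ _ _ _ _ ⟩
      ι u * ι u + ι A * (ι v * ι v) + ((1# + 1#) * (ι u * ι v) + ι B * (ι v * ι v)) * θ
        ≈⟨ +-cong (ι-norm u v) (*-congʳ ι-cross) ⟨
      combine (norm u v) ((K.1# K.+ K.1#) K.* (u K.* v) K.+ B K.* (v K.* v)) ∎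
      where
      ι-norm : ∀ u v → ι (norm u v) ≈ ι u * ι u + ι A * (ι v * ι v)
      ι-norm u v = trans (ι-+ _ _) (+-cong (ι-* u u) (trans (ι-* A _) (*-congˡ (ι-* v v))))
      ι-cross : ι ((K.1# K.+ K.1#) K.* (u K.* v) K.+ B K.* (v K.* v)) ≈ (1# + 1#) * (ι u * ι v) + ι B * (ι v * ι v)
      ι-cross = trans (ι-+ _ _) (+-cong
        (trans (ι-* _ _) (*-cong (trans (ι-+ _ _) (+-cong ι-1 ι-1)) (ι-* u v)))
        (trans (ι-* B _) (*-congˡ (ι-* v v))))

    combine-- : ∀ u v u′ v′ → combine u v - combine u′ v′ ≈ combine (u K.- u′) (v K.- v′)
    combine-- u v u′ v′ = begin
      combine u v - combine u′ v′
        ≈⟨ solve 5 (λ u v u′ v′ t → (u :+ v :* t) :- (u′ :+ v′ :* t) :=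
             u :- u′ :+ (v :- v′) :* t) refl _ _ _ _ _ ⟩
      ι u - ι u′ + (ι v - ι v′) * θ
        ≈⟨ +-cong (ι-sub u u′) (*-congʳ (ι-sub v v′)) ⟨
      combine (u K.- u′) (v K.- v′) ∎
      where
      ι-sub : ∀ u v → ι (u K.- v) ≈ ι u - ι v
      ι-sub u v = trans (ι-+ u _) (+-congˡ (ι-neg v))

    combine-0 : ∀ {u} → u K.≈ K.0# → ∀ v → combine u v ≈ ι v * θ
    combine-0 u≈0 v = trans (+-congʳ (trans (ι-cong u≈0) ι-0)) (L.+-identityˡ _)

    θ-scale-injective : ∀ {s t} → ι s * θ ≈ ι t * θ → s K.≈ t
    θ-scale-injective eq = proj₂ (combine-injective (trans (combine-0 K.refl _) (trans eq (sym (combine-0 K.refl _)))))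

    module _ (f : Fun L) (G : Inverse setoid setoid) (f≈G² : IsSquareOf L f G) where
      open Func f renaming (to to f⟨_⟩; cong to f-cong)
      private
        module G = Inverse G
        module P = Setoid (Points L)
        U = 𝒰 emb θ

      -- The coordinates (u , w) of G (x + m) run bijectively over K × K as x runs over L, and the
      -- affine point of the line above x lies in the unital exactly when (u , w) is on the conic
      -- for b₀.
      line-size : ∀ m v → SubsetHasSize (Points L) (U ∩ Π L f L[ m , v ]) 1
                        ⊎ SubsetHasSize (Points L) (U ∩ Π L f L[ m , v ]) (q ℕ.+ 1)
      line-size m v with b₀ , b₁ , b≈v ← combine-surjective v = ⊎.map transfer transfer (conic-size b₀)
        where
        abscissa : K.Carrier × K.Carrier → L.Carrier
        abscissa (u , w) = G.from (combine u w) - m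
        point : K.Carrier × K.Carrier → Point L
        point z = aff (abscissa z) (f⟨ abscissa z + m ⟩ - v)
        module Z = Setoid (K.setoid ×ₛ K.setoid)
        abscissa-cong : ∀ {z z′} → z Z.≈ z′ → abscissa z ≈ abscissa z′
        abscissa-cong (u≈ , w≈) = +-congʳ (G.from-cong (combine-cong u≈ w≈))
        G-abscissa : ∀ u w → G.to (abscissa (u , w) + m) ≈ combine u w
        G-abscissa u w = G.inverseˡ (solve 2 (λ x m → x :- m :+ m := x) refl _ _)
        ordinate : ∀ x u w → G.to (x + m) ≈ combine u w →
                   f⟨ x + m ⟩ - v ≈ combine (norm u w K.- b₀) ((K.1# K.+ K.1#) K.* (u K.* w) K.+ B K.* (w K.* w) K.- b₁)
        ordinate x u w Gx≈ = begin
          f⟨ x + m ⟩ - v                              ≈⟨ +-cong (f≈G² _) (L.-‿cong (sym b≈v)) ⟩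
          G.to (x + m) * G.to (x + m) - combine b₀ b₁ ≈⟨ +-congʳ (trans (*-cong Gx≈ Gx≈) (combine-square u w)) ⟩
          _                                           ≈⟨ combine-- _ _ _ _ ⟩
          _                                           ∎
        transfer : ∀ {k} → SubsetHasSize (K.setoid ×ₛ K.setoid) (OnConic b₀) k →
                   SubsetHasSize (Points L) (U ∩ Π L f L[ m , v ]) k
        transfer size = size-subset {A = subset (K.setoid ×ₛ K.setoid) (OnConic b₀)} {S = Points L} size
          (λ (z , _) → point z)
          (λ z≈ → Sum.inj₁ (abscissa-cong z≈ , +-congʳ (f-cong (+-congʳ (abscissa-cong z≈)))))
          (λ ((u , w) , on) →
            inj₁ (_ , _ , Sum.inj₁ (refl , trans (ordinate _ u w (G-abscissa u w)) (combine-0 (K.x≈y⇒x∙y⁻¹≈ε on) _))) ,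
            inj₁ (_ , P.refl))
          (λ { {(u , w) , _} {(u′ , w′) , _} (Sum.inj₁ (x≈ , _)) → combine-injective
            (trans (sym (G-abscissa u w)) (trans (G.to-cong (+-congʳ x≈)) (G-abscissa u′ w′))) })
          hit
          where
          hit : ∀ {P} → (U ∩ Π L f L[ m , v ]) P →
                ∃ λ (z : Setoid.Carrier (subset (K.setoid ×ₛ K.setoid) (OnConic b₀))) → point (proj₁ z) P.≈ P
          hit {aff x y} (inj₁ (_ , t , Sum.inj₁ (_ , y≈tθ)) , inj₁ (x′ , Sum.inj₁ (x≈x′ , y≈)))
            with u , w , eq ← combine-surjective (G.to (x + m))
            = ((u , w) , K.x∙y⁻¹≈ε⇒x≈y _ _ (proj₁ (combine-injective (begin
                _                    ≈⟨ ordinate x u w (sym eq) ⟨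
                f⟨ x + m ⟩ - v       ≈⟨ y≈f ⟨
                y                    ≈⟨ y≈tθ ⟩
                ι t * θ              ≈⟨ combine-0 K.refl t ⟨
                combine K.0# t       ∎)))) ,
              Sum.inj₁ (abscissa≈x , trans (+-congʳ (f-cong (+-congʳ abscissa≈x))) (sym y≈f))
            where
            y≈f : y ≈ f⟨ x + m ⟩ - v
            y≈f = trans y≈ (+-congʳ (f-cong (+-congʳ (sym x≈x′))))
            abscissa≈x : abscissa (u , w) ≈ x
            abscissa≈x = trans (+-congʳ (G.inverseʳ eq)) (solve 2 (λ x m → x :+ m :- m := x) refl _ _)
          -- At infinity the line has only `dir m` and the unital only `dir∞`, so all common points
          -- are affine.
          hit {aff x y} (inj₁ _ , inj₂ ())
          hit {aff x y} (inj₂ () , _)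
          hit {dir k} (inj₁ (_ , _ , ()) , _)
          hit {dir k} (inj₂ (Sum.inj₂ ()) , _)
          hit {dir∞} (inj₁ (_ , _ , ()) , _)
          hit {dir∞} (inj₂ _ , inj₁ (_ , ()))
          hit {dir∞} (inj₂ _ , inj₂ (Sum.inj₂ ()))

      unital : IsUnital L q f U
      unital = record { size = size ; meets = meets }
        where
        M : ∀ {a b} → Setoid a b → Setoid a _
        M = Maybe.setoid
        size : SubsetHasSize (Points L) U (q ℕ.^ 3 ℕ.+ 1)
        size = size-subset {A = M (setoid ×ₛ K.setoid)} {S = Points L}
          (≡.subst (λ k → HasSize (M (setoid ×ₛ K.setoid)) (k ℕ.+ 1)) (ℕ.*-comm (q ℕ.^ 2) q) (size-Maybe (size-× L.hasOrder K.hasOrder)))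
          h (λ { (Maybe.just (x≈ , t≈)) → Sum.inj₁ (x≈ , *-congʳ (ι-cong t≈)) ; Maybe.nothing → P.refl })
          (λ { (just (x , t)) → inj₁ (x , t , P.refl) ; nothing → inj₂ P.refl })
          (λ { {just _} {just _} (Sum.inj₁ (x≈ , y≈)) → Maybe.just (x≈ , θ-scale-injective y≈)
             ; {just _} {nothing} ()
             ; {nothing} {just _} ()
             ; {nothing} {nothing} _ → Maybe.nothing })
          λ { (inj₁ (x , t , eq)) → just (x , t) , P.sym eq ; (inj₂ eq) → nothing , P.sym eq }
          where
          h : Maybe (L.Carrier × K.Carrier) → Point L
          h (just (x , t)) = aff x (ι t * θ)
          h nothing        = dir∞
        -- A vertical line contributes the q ordinates in K θ and ∞, and the line at infinity is
        -- tangent at ∞.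
        meets : ∀ l → SubsetHasSize (Points L) (U ∩ Π L f l) 1 ⊎ SubsetHasSize (Points L) (U ∩ Π L f l) (q ℕ.+ 1)
        meets L[ m , v ] = line-size m v
        meets N[ m ] = inj₂ (size-subset {A = M K.setoid} {S = Points L} (size-Maybe K.hasOrder) h
          (λ { (Maybe.just t≈) → Sum.inj₁ (refl , *-congʳ (ι-cong t≈)) ; Maybe.nothing → P.refl })
          (λ { (just t) → inj₁ (m , t , P.refl) , inj₁ (_ , P.refl) ; nothing → inj₂ P.refl , inj₂ P.refl })
          (λ { {just _} {just _} (Sum.inj₁ (_ , y≈)) → Maybe.just (θ-scale-injective y≈)
             ; {just _} {nothing} ()
             ; {nothing} {just _} ()
             ; {nothing} {nothing} _ → Maybe.nothing })
          hit)
          where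
          h : Maybe K.Carrier → Point L
          h (just t) = aff m (ι t * θ)
          h nothing  = dir∞
          hit : ∀ {P} → (U ∩ Π L f N[ m ]) P → ∃ λ t → h t P.≈ P
          hit {P} (inj₂ eq , _) = nothing , P.sym {P} eq
          hit {aff x y} (inj₁ (_ , t , Sum.inj₁ (_ , y≈)) , inj₁ (_ , Sum.inj₁ (x≈ , _))) =
            just t , Sum.inj₁ (sym x≈ , sym y≈)
          hit {aff x y} (inj₁ _ , inj₂ ())
          hit {dir k} (inj₁ (_ , _ , ()) , _)
          hit {dir∞} (inj₁ (_ , _ , ()) , _)
        meets L∞ = inj₁ (size-subset {A = ≡.setoid (Fin 1)} {S = Points L} (Identity.inverse _) (λ _ → dir∞) (λ _ → P.refl)
          (λ _ → inj₂ P.refl , nothing , P.refl) (λ { {zero} {zero} _ → ≡.refl }) hit)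
          where
          hit : ∀ {P} → (U ∩ Π L f L∞) P → ∃ λ (_ : Fin 1) → dir∞ P.≈ P
          hit {P} (inj₂ eq , _) = zero , P.sym {P} eq
          hit {aff x y} (inj₁ _ , _ , ())
          hit {dir k} (inj₁ (_ , _ , ()) , _)
          hit {dir∞} (inj₁ (_ , _ , ()) , _)

-- Planar power functions

module PlanarPowers {N} (F : FiniteField c ℓ N) (2≉0 : OddCharacteristic F) where
  open FiniteField F hiding (zero)
  open FiniteFieldProperties F
  open Relation.Binary.Reasoning.Setoid setoid

  injective⇒planar : (f : Fun F) → let open Func f in
    (∀ e → ¬ e ≈ 0# → Injective _≈_ _≈_ (λ x → to (x + e) - to x)) → Planar F f
  injective⇒planar f inj e e≉0 = inj e e≉0 , λ y →
    let x , eq = injective⇒surjective hasOrder hasOrder (inj e e≉0) y in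
    x , λ z≈x → trans (+-cong (f-cong (+-congʳ z≈x)) (-‿cong (f-cong z≈x))) eq
    where open Func f using () renaming (cong to f-cong)

  double≈0⇒≈0 : ∀ {x} → x + x ≈ 0# → x ≈ 0#
  double≈0⇒≈0 {x} eq = [ (λ 2≈0 → contradiction 2≈0 2≉0) , (λ x≈0 → x≈0) ]′
    (integral (trans (solve 1 (λ x → :2 :* x := x :+ x) refl x) eq))

  ^-neg-odd : ∀ x j → (- x) ^ suc (j ℕ.* 2) ≈ - (x ^ suc (j ℕ.* 2))
  ^-neg-odd x zero    = solve 1 (λ x → :- x :* :1 := :- (x :* :1)) refl x
  ^-neg-odd x (suc j) = begin
    - x * (- x * (- x) ^ suc (j ℕ.* 2))   ≈⟨ *-congˡ (*-congˡ (^-neg-odd x j)) ⟩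
    - x * (- x * - (x ^ suc (j ℕ.* 2)))   ≈⟨ solve 2 (λ x y → :- x :* (:- x :* :- y) := :- (x :* (x :* y))) refl x _ ⟩
    - (x * (x * x ^ suc (j ℕ.* 2)))       ∎

  -- A planar even function takes each value at most at x and - x, while x ^ e is odd.
  planar⇒square : ∀ {d} j → let e = suc (j ℕ.* 2) in d ≡ e ℕ.+ e → Planar F (power F d) →
                  ∃ (IsSquareOf F (power F d))
  planar⇒square {d} j ≡.refl planar = Bijection⇒Inverse bijection , λ x → ^-homo-* x e e
    where
    e = suc (j ℕ.* 2)
    half = (1# + 1#) ⁻¹⟨ 2≉0 ⟩
    half+half≈1 : half + half ≈ 1#
    half+half≈1 = trans (solve 1 (λ h → h :+ h := :2 :* h) refl half) (*-inverseʳ 2≉0)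
    power-injective : Injective _≈_ _≈_ (_^ e)
    power-injective {x} {y} xᵉ≈yᵉ with (y - x) ≟ 0#
    ... | yes y-x≈0 = sym (x∙y⁻¹≈ε⇒x≈y y x y-x≈0)
    ... | no δ≉0 = trans x≈0 (sym y≈0)
      where
      δ = y - x
      -- The midpoint trick: h + δ = - h, so for the even exponent d the difference with shift δ
      -- vanishes at h as well as at x. Planarity gives x = h and y = - h, and then x ^ e = y ^ e =
      -- - x ^ e forces both to be 0.
      h = - (half * δ)
      power-d : ∀ {x y} → x ^ e ≈ y ^ e → x ^ d ≈ y ^ d
      power-d {x} {y} eq = trans (^-homo-* x e e) (trans (*-cong eq eq) (sym (^-homo-* y e e)))
      x+δ≈y : x + δ ≈ y
      x+δ≈y = solve 2 (λ x y → x :+ (y :- x) := y) refl x y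
      h+δ≈-h : h + δ ≈ - h
      h+δ≈-h = begin
        - (half * δ) + δ                    ≈⟨ +-congˡ (trans (*-congʳ half+half≈1) (*-identityˡ δ)) ⟨
        - (half * δ) + (half + half) * δ    ≈⟨ solve 2 (λ h δ → :- (h :* δ) :+ (h :+ h) :* δ := :- (:- (h :* δ))) refl half δ ⟩
        - h                                 ∎
      [-h]ᵉ≈-hᵉ : (h + δ) ^ e ≈ - (h ^ e)
      [-h]ᵉ≈-hᵉ = trans (^-congˡ e h+δ≈-h) (^-neg-odd h j)
      difference-x : (x + δ) ^ d - x ^ d ≈ 0#
      difference-x = x≈y⇒x∙y⁻¹≈ε (power-d (trans (^-congˡ e x+δ≈y) (sym xᵉ≈yᵉ)))
      difference-h : (h + δ) ^ d - h ^ d ≈ 0#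
      difference-h = x≈y⇒x∙y⁻¹≈ε (begin
        (h + δ) ^ d                ≈⟨ ^-homo-* (h + δ) e e ⟩
        (h + δ) ^ e * (h + δ) ^ e  ≈⟨ *-cong [-h]ᵉ≈-hᵉ [-h]ᵉ≈-hᵉ ⟩
        - (h ^ e) * - (h ^ e)      ≈⟨ solve 1 (λ u → :- u :* :- u := u :* u) refl _ ⟩
        h ^ e * h ^ e              ≈⟨ ^-homo-* h e e ⟨
        h ^ d                      ∎)
      x≈h : x ≈ h
      x≈h = proj₁ (planar δ δ≉0) (trans difference-x (sym difference-h))
      hᵉ≈-hᵉ : h ^ e ≈ - (h ^ e)
      hᵉ≈-hᵉ = begin
        h ^ e         ≈⟨ ^-congˡ e x≈h ⟨
        x ^ e         ≈⟨ xᵉ≈yᵉ ⟩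
        y ^ e         ≈⟨ ^-congˡ e x+δ≈y ⟨
        (x + δ) ^ e   ≈⟨ ^-congˡ e (+-congʳ x≈h) ⟩
        (h + δ) ^ e   ≈⟨ [-h]ᵉ≈-hᵉ ⟩
        - (h ^ e)     ∎
      xᵉ≈0 : x ^ e ≈ 0#
      xᵉ≈0 = trans (^-congˡ e x≈h) (double≈0⇒≈0 (trans (+-congˡ hᵉ≈-hᵉ) (-‿inverseʳ _)))
      x≈0 : x ≈ 0#
      x≈0 = ^≈0⇒≈0 e xᵉ≈0
      y≈0 : y ≈ 0#
      y≈0 = ^≈0⇒≈0 e (trans (sym xᵉ≈yᵉ) xᵉ≈0)
    bijection : Bijection setoid setoid
    bijection = record
      { to = _^ e ; cong = ^-congˡ e
      ; bijective = power-injective , λ y →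
          let x , eq = injective⇒surjective hasOrder hasOrder power-injective y in
          x , λ z≈x → trans (^-congˡ e z≈x) eq }

  module FrobeniusPlanar (Q : ℕ) (Q-additive : ∀ x y → (x + y) ^ Q ≈ x ^ Q + y ^ Q)
                         (j : ℕ) (Q-odd : Q ≡ suc (j ℕ.* 2)) where
    ^Q-neg : ∀ x → (- x) ^ Q ≈ - (x ^ Q)
    ^Q-neg x rewrite Q-odd = ^-neg-odd x j

    iterate-even : ∀ {z} → z ^ Q ≈ - z → ∀ i → z ^ (Q ℕ.^ (i ℕ.* 2)) ≈ z
    iterate-even {z} eq zero    = *-identityʳ z
    iterate-even {z} eq (suc i) = begin
      z ^ (Q ℕ.* (Q ℕ.* Q²ⁱ))  ≈⟨ ^-assocʳ z Q (Q ℕ.* Q²ⁱ) ⟨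
      (z ^ Q) ^ (Q ℕ.* Q²ⁱ)    ≈⟨ ^-assocʳ (z ^ Q) Q Q²ⁱ ⟨
      ((z ^ Q) ^ Q) ^ Q²ⁱ      ≈⟨ ^-congˡ Q²ⁱ (^-congˡ Q eq) ⟩
      ((- z) ^ Q) ^ Q²ⁱ        ≈⟨ ^-congˡ Q²ⁱ (trans (^Q-neg z) (trans (-‿cong eq) (solve 1 (λ z → :- (:- z) := z) refl z))) ⟩
      z ^ Q²ⁱ                  ≈⟨ iterate-even eq i ⟩
      z                        ∎
      where Q²ⁱ = Q ℕ.^ (i ℕ.* 2)

    iterate-odd : ∀ {z} → z ^ Q ≈ - z → ∀ i → z ^ (Q ℕ.^ suc (i ℕ.* 2)) ≈ - z
    iterate-odd {z} eq i = begin
      z ^ (Q ℕ.* Q²ⁱ)   ≈⟨ ^-assocʳ z Q Q²ⁱ ⟨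
      (z ^ Q) ^ Q²ⁱ     ≈⟨ ^-congˡ Q²ⁱ eq ⟩
      (- z) ^ Q²ⁱ       ≈⟨ iterate-even (trans (^Q-neg z) (-‿cong eq)) i ⟩
      - z               ∎
      where Q²ⁱ = Q ℕ.^ (i ℕ.* 2)

    -- Up to a constant the difference function is the additive map sending d to d ^ Q e + e ^ Q d.
    -- Dividing by e ^ (Q + 1) turns its kernel into the solutions z = d / e of z ^ Q = - z.
    power[Q+1]-planar : ∀ i → (∀ z → z ^ (Q ℕ.^ suc (i ℕ.* 2)) ≈ z) → Planar F (power F (Q ℕ.+ 1))
    power[Q+1]-planar i periodic = injective⇒planar (power F (Q ℕ.+ 1)) injective
      where
      injective : ∀ e → ¬ e ≈ 0# → Injective _≈_ _≈_ (λ x → (x + e) ^ (Q ℕ.+ 1) - x ^ (Q ℕ.+ 1))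
      injective e e≉0 {x} {y} eq = x∙y⁻¹≈ε⇒x≈y x y d≈0
        where
        d = x - y
        w = e ⁻¹⟨ e≉0 ⟩
        z = d * w
        expand : ∀ x → (x + e) ^ (Q ℕ.+ 1) - x ^ (Q ℕ.+ 1) ≈ x ^ Q * e + e ^ Q * x + e ^ Q * e
        expand x = begin
          (x + e) ^ (Q ℕ.+ 1) - x ^ (Q ℕ.+ 1)
            ≈⟨ +-cong (^-suc-comm _ Q) (-‿cong (^-suc-comm x Q)) ⟩
          (x + e) ^ Q * (x + e) - x ^ Q * x
            ≈⟨ +-congʳ (*-congʳ (Q-additive x e)) ⟩
          (x ^ Q + e ^ Q) * (x + e) - x ^ Q * x
            ≈⟨ solve 4 (λ x e X E → (X :+ E) :* (x :+ e) :- X :* x := X :* e :+ E :* x :+ E :* e) refl x e _ _ ⟩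
          x ^ Q * e + e ^ Q * x + e ^ Q * e ∎
        x^Q : x ^ Q ≈ d ^ Q + y ^ Q
        x^Q = trans (^-congˡ Q (solve 2 (λ x y → x := x :- y :+ y) refl x y)) (Q-additive d y)
        d≈ze : d ≈ z * e
        d≈ze = sym (trans (*-assoc d w e) (trans (*-congˡ (*-inverseˡ e≉0)) (*-identityʳ d)))
        kernel : (z ^ Q + z) * (e ^ Q * e) ≈ 0#
        kernel = begin
          (z ^ Q + z) * (e ^ Q * e)
            ≈⟨ solve 4 (λ Z z E e → (Z :+ z) :* (E :* e) := (Z :* E) :* e :+ E :* (z :* e)) refl _ _ _ _ ⟩
          (z ^ Q * e ^ Q) * e + e ^ Q * (z * e)
            ≈⟨ +-cong (*-congʳ (^-distrib-* z e Q)) refl ⟨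
          (z * e) ^ Q * e + e ^ Q * (z * e)
            ≈⟨ +-cong (*-congʳ (^-congˡ Q d≈ze)) (*-congˡ d≈ze) ⟨
          d ^ Q * e + e ^ Q * d
            ≈⟨ solve 6 (λ D E Y e x y → D :* e :+ E :* (x :- y) :=
                 (((D :+ Y) :* e :+ E :* x :+ E :* e) :- (Y :* e :+ E :* y :+ E :* e))) refl _ _ (y ^ Q) e x y ⟩
          ((d ^ Q + y ^ Q) * e + e ^ Q * x + e ^ Q * e) - (y ^ Q * e + e ^ Q * y + e ^ Q * e)
            ≈⟨ +-congʳ (+-congʳ (+-congʳ (*-congʳ x^Q))) ⟨
          (x ^ Q * e + e ^ Q * x + e ^ Q * e) - (y ^ Q * e + e ^ Q * y + e ^ Q * e)
            ≈⟨ x≈y⇒x∙y⁻¹≈ε (trans (sym (expand x)) (trans eq (expand y))) ⟩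
          0# ∎
        z^Q≈-z : z ^ Q ≈ - z
        z^Q≈-z = [ inverseˡ-unique (z ^ Q) z
                 , (λ eq → contradiction eq (*-≉0 (λ e^Q≈0 → e≉0 (^≈0⇒≈0 Q e^Q≈0)) e≉0)) ]′ (integral kernel)
        z≈0 : z ≈ 0#
        z≈0 = double≈0⇒≈0 (trans (+-congˡ (trans (sym (periodic z)) (iterate-odd z^Q≈-z i))) (-‿inverseʳ z))
        d≈0 : d ≈ 0#
        d≈0 = trans d≈ze (trans (*-congʳ z≈0) (zeroˡ e))

-- Arithmetic of the numbers (3 ^ k - 1) / 2

[3^_-1]/2 : ℕ → ℕ
[3^ zero  -1]/2 = 0
[3^ suc k -1]/2 = suc (3 ℕ.* [3^ k -1]/2)

3^≡1+2m : ∀ k → 3 ℕ.^ k ≡ suc ([3^ k -1]/2 ℕ.* 2)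
3^≡1+2m zero    = ≡.refl
3^≡1+2m (suc k) = ≡.trans (≡.cong (3 ℕ.*_) (3^≡1+2m k))
  (solve 1 (λ m → con 3 :* (con 1 :+ m :* con 2) := con 1 :+ (con 1 :+ con 3 :* m) :* con 2) ≡.refl [3^ k -1]/2)
  where open +-*-Solver

-- Two steps of the recursion send m to 9 m + 4, which preserves the class 1 modulo 4. Hence m is
-- odd, as coprimality requires, and the exponent m + 1 is twice an odd number.
[3^odd-1]/2≡1+4s : ∀ j → ∃ λ s → [3^ suc (j ℕ.* 2) -1]/2 ≡ suc (s ℕ.* 4)
[3^odd-1]/2≡1+4s zero    = 0 , ≡.refl
[3^odd-1]/2≡1+4s (suc j) with s , eq ← [3^odd-1]/2≡1+4s j =
  suc (suc (suc (s ℕ.* 9))) , ≡.trans (≡.cong (λ m → suc (3 ℕ.* suc (3 ℕ.* m))) eq)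
    (solve 1 (λ s → con 1 :+ con 3 :* (con 1 :+ con 3 :* (con 1 :+ s :* con 4)) :=
                    con 1 :+ (con 3 :+ s :* con 9) :* con 4) ≡.refl s)
  where open +-*-Solver

module _ (d : ℕ) where
  OneMod : ℕ → Set
  OneMod x = ∃ λ s → x ≡ suc (s ℕ.* d)

  OneMod-^ : ∀ {x} → OneMod x → ∀ i → OneMod (x ℕ.^ i)
  OneMod-^ one zero = 0 , ≡.refl
  OneMod-^ one@(s , ≡.refl) (suc i) with t , eq ← OneMod-^ one i =
    s ℕ.+ t ℕ.+ s ℕ.* d ℕ.* t , ≡.trans (≡.cong (suc (s ℕ.* d) ℕ.*_) eq)
      (solve 3 (λ s t d → (con 1 :+ s :* d) :* (con 1 :+ t :* d) :=
                          con 1 :+ (s :+ t :+ s :* d :* t) :* d) ≡.refl s t d)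
    where open +-*-Solver

  OneMod-3*⇒∣2 : ∀ {x y} → OneMod x → OneMod y → 3 ℕ.* x ≡ y → d ∣ 2
  OneMod-3*⇒∣2 (s , ≡.refl) (t , ≡.refl) eq = ∣m+n∣m⇒∣n {m = 3 ℕ.* s ℕ.* d}
    (divides t (ℕ.suc-injective (≡.trans
      (solve 2 (λ s d → con 1 :+ (con 3 :* s :* d :+ con 2) := con 3 :* (con 1 :+ s :* d)) ≡.refl s d) eq)))
    (n∣m*n (3 ℕ.* s))
    where open +-*-Solver

  -- By Bézout for the exponents, 3 is congruent to 1 modulo d.
  coprime-exponents⇒∣2 : ∀ {k l} → Coprime k l → OneMod (3 ℕ.^ k) → OneMod (3 ℕ.^ l) → d ∣ 2
  coprime-exponents⇒∣2 {k} {l} coprime one-k one-l with coprime-Bézout coprime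
  ... | Bézout.+- x y eq = OneMod-3*⇒∣2 (OneMod-^ one-l y) (OneMod-^ one-k x) (≡.trans
        (≡.cong (3 ℕ.*_) (≡.trans (ℕ.^-*-assoc 3 l y) (≡.cong (3 ℕ.^_) (ℕ.*-comm l y))))
        (≡.trans (≡.cong (3 ℕ.^_) eq)
        (≡.trans (≡.cong (3 ℕ.^_) (ℕ.*-comm x k)) (≡.sym (ℕ.^-*-assoc 3 k x)))))
  ... | Bézout.-+ x y eq = OneMod-3*⇒∣2 (OneMod-^ one-k x) (OneMod-^ one-l y) (≡.trans
        (≡.cong (3 ℕ.*_) (≡.trans (ℕ.^-*-assoc 3 k x) (≡.cong (3 ℕ.^_) (ℕ.*-comm k x))))
        (≡.trans (≡.cong (3 ℕ.^_) eq)
        (≡.trans (≡.cong (3 ℕ.^_) (ℕ.*-comm y l)) (≡.sym (ℕ.^-*-assoc 3 l y)))))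

2∤1+2n : ∀ n → ¬ 2 ∣ suc (n ℕ.* 2)
2∤1+2n n 2∣ with () ← ∣1⇒≡1 (∣m+n∣m⇒∣n {m = n ℕ.* 2} (≡.subst (2 ∣_) (ℕ.+-comm 1 (n ℕ.* 2)) 2∣) (n∣m*n n))

-- Passes from 2 n, the exponent of 3 in |L|, to 4 n, since the Dickson modulus is |L| ² - 1.
coprime-double : ∀ {k l} → Coprime k (2 ℕ.* l) → Coprime k (2 ℕ.* l ℕ.* 2)
coprime-double {k} {l} coprime {d} (d∣k , d∣4l) = coprime (d∣k , ∣-trans d∣2 (m∣m*n l))
  where
  d∣2 : d ∣ 2
  d∣2 = coprime-divisor (λ (i∣d , i∣2l) → coprime (∣-trans i∣d d∣k , i∣2l)) d∣4l

-- A common divisor divides both 3 ^ k - 1 and 3 ^ l - 1, hence 3 - 1 = 2; as k is odd, (3 ^ k - 1)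
-- / 2 is odd and the divisor 2 is excluded.
coprime-[3^k-1]/2 : ∀ {k l j t} → Coprime k l → k ≡ suc (j ℕ.* 2) → 3 ℕ.^ l ≡ suc t → Coprime [3^ k -1]/2 t
coprime-[3^k-1]/2 {k} {l} {j} {t} coprime k-odd 3^l≡1+t {d} (divides x eq-x , divides y eq-y) =
  [ (λ eq → eq) , (λ d≡2 → contradiction (≡.subst (_∣ [3^ k -1]/2) d≡2 (divides x eq-x)) m-odd) ]′
    (prime⇒irreducible prime[2] d∣2)
  where
  d∣2 : d ∣ 2
  d∣2 = coprime-exponents⇒∣2 d coprime
    (2 ℕ.* x , ≡.trans (3^≡1+2m k) (≡.cong suc (≡.trans (≡.cong (ℕ._* 2) eq-x)
      (solve 2 (λ x d → x :* d :* con 2 := con 2 :* x :* d) ≡.refl x d))))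
    (y , ≡.trans 3^l≡1+t (≡.cong suc eq-y))
    where open +-*-Solver
  m-odd : ¬ 2 ∣ [3^ k -1]/2
  m-odd rewrite k-odd with s , eq ← [3^odd-1]/2≡1+4s j = λ 2∣m →
    2∤1+2n (s ℕ.* 2) (≡.subst (2 ∣_) (≡.trans eq (≡.cong suc (≡.sym (ℕ.*-assoc s 2 2)))) 2∣m)

-- The Dickson polynomials of the first kind, characterised by D n (y + y⁻¹) = yⁿ + y⁻ⁿ.
module Dickson (R : CommutativeRing c ℓ) where
  open CommutativeRing R hiding (zero)
  open Algebra.Properties.CommutativeSemiring.Exp commutativeSemiring
  open CommutativeRingProperties R
  open IntegerCoefficients R
  open Relation.Binary.Reasoning.Setoid setoid

  D : ℕ → Carrier → Carrier
  D zero          x = 1# + 1#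
  D (suc zero)    x = x
  D (suc (suc n)) x = x * D (suc n) x - D n x

  D-cong : ∀ n {x y} → x ≈ y → D n x ≈ D n y
  D-cong zero          x≈y = refl
  D-cong (suc zero)    x≈y = x≈y
  D-cong (suc (suc n)) x≈y = +-cong (*-cong x≈y (D-cong (suc n) x≈y)) (-‿cong (D-cong n x≈y))

  D-index : ∀ {m n x} → m ≡ n → D m x ≈ D n x
  D-index ≡.refl = refl

  -- This expands (yˢ + y⁻ˢ) (yᵇ + y⁻ᵇ). The index `a` stands for s - b, which avoids truncated
  -- subtraction.
  D-product : ∀ b {a s t} → s ≡ b ℕ.+ a → t ≡ b ℕ.+ s → ∀ x → D s x * D b x ≈ D t x + D a x
  D-product zero       ≡.refl ≡.refl x = solve 1 (λ u → u :* :2 := u :+ u) refl _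
  D-product (suc zero) {a} ≡.refl ≡.refl x =
    solve 3 (λ x u v → u :* x := x :* u :- v :+ v) refl x (D (suc a) x) (D a x)
  D-product (suc (suc b)) {a} {s} {t} s≡ t≡ x = begin
    D s x * (x * D (suc b) x - D b x)
      ≈⟨ solve 4 (λ x u v w → u :* (x :* v :- w) := x :* (u :* v) :- u :* w) refl x _ _ _ ⟩
    x * (D s x * D (suc b) x) - D s x * D b x
      ≈⟨ +-cong (*-congˡ (D-product (suc b) {suc a} (≡.trans s≡ (≡.cong suc (≡.sym (ℕ.+-suc b a)))) ≡.refl x))
           (-‿cong (D-product b {suc (suc a)} (≡.trans s≡ (≡.sym (≡.trans (ℕ.+-suc b (suc a)) (≡.cong suc (ℕ.+-suc b a))))) ≡.refl x)) ⟩
    x * (D (suc b ℕ.+ s) x + D (suc a) x) - (D (b ℕ.+ s) x + (x * D (suc a) x - D a x))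
      ≈⟨ solve 5 (λ x u v w y → x :* (u :+ v) :- (w :+ (x :* v :- y)) := x :* u :- w :+ y) refl x _ _ _ _ ⟩
    D (suc (suc (b ℕ.+ s))) x + D a x
      ≈⟨ +-congʳ (D-index (≡.sym t≡)) ⟩
    D t x + D a x ∎

  -- By the product rule the values at multiples of `m` satisfy the Dickson recurrence with `D m x`
  -- in place of `x`.
  D-compose : ∀ r m x → D r (D m x) ≈ D (r ℕ.* m) x
  D-compose zero          m x = refl
  D-compose (suc zero)    m x = D-index (≡.sym (ℕ.+-identityʳ m))
  D-compose (suc (suc r)) m x = begin
    D m x * D (suc r) (D m x) - D r (D m x)
      ≈⟨ +-cong (*-congˡ (D-compose (suc r) m x)) (-‿cong (D-compose r m x)) ⟩
    D m x * D (suc r ℕ.* m) x - D (r ℕ.* m) x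
      ≈⟨ +-congʳ (trans (*-comm _ _) (D-product m ≡.refl ≡.refl x)) ⟩
    D (suc (suc r) ℕ.* m) x + D (r ℕ.* m) x - D (r ℕ.* m) x
      ≈⟨ solve 2 (λ u v → u :+ v :- v := u) refl _ _ ⟩
    D (suc (suc r) ℕ.* m) x ∎

  D-double : ∀ j x → D (2 ℕ.* j) x ≈ D j x * D j x - (1# + 1#)
  D-double j x = begin
    D (2 ℕ.* j) x                                    ≈⟨ solve 2 (λ u v → u := u :+ v :- v) refl _ (1# + 1#) ⟩
    D (2 ℕ.* j) x + (1# + 1#) - (1# + 1#)            ≈⟨ +-congʳ (D-product j {0} ≡.refl ≡.refl x) ⟨
    D (j ℕ.+ 0) x * D j x - (1# + 1#)                ≈⟨ +-congʳ (*-congʳ (D-index (ℕ.+-identityʳ j))) ⟩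
    D j x * D j x - (1# + 1#)                        ∎

  Period : ℕ → Carrier → Set ℓ
  Period s x = ∀ i → D (i ℕ.+ s) x ≈ D i x

  -- The recurrence has order two, so agreement with the initial values 2 and x propagates.
  period : ∀ {s x} → D s x ≈ 1# + 1# → D (suc s) x ≈ x → Period s x
  period Ds Ds+1 zero          = Ds
  period Ds Ds+1 (suc zero)    = Ds+1
  period Ds Ds+1 (suc (suc i)) = +-cong (*-congˡ (period Ds Ds+1 (suc i))) (-‿cong (period Ds Ds+1 i))

  Period-* : ∀ {s x} → Period s x → ∀ j → Period (j ℕ.* s) x
  Period-* {s} per zero    i = D-index (ℕ.+-identityʳ i)
  Period-* {s} per (suc j) i = trans (D-index (≡.sym (ℕ.+-assoc i s (j ℕ.* s))))
    (trans (Period-* per j (i ℕ.+ s)) (per i))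

  module Characteristic3 (3≈0 : 1# + 1# + 1# ≈ 0#) where
    -- The third Dickson polynomial is u ³ - 3 u, which is the Frobenius map in characteristic 3.
    D-triple : ∀ j x → D (3 ℕ.* j) x ≈ D j x ^ 3
    D-triple j x = begin
      D (3 ℕ.* j) x
        ≈⟨ solve 2 (λ u v → u := u :+ v :- v) refl _ (D j x) ⟩
      D (3 ℕ.* j) x + D j x - D j x
        ≈⟨ +-congʳ (+-congˡ (D-index (≡.sym (ℕ.+-identityʳ j)))) ⟩
      D (3 ℕ.* j) x + D (j ℕ.+ 0) x - D j x
        ≈⟨ +-congʳ (D-product j {j ℕ.+ 0} ≡.refl ≡.refl x) ⟨
      D (2 ℕ.* j) x * D j x - D j x
        ≈⟨ +-congʳ (*-congʳ (D-double j x)) ⟩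
      (D j x * D j x - (1# + 1#)) * D j x - D j x
        ≈⟨ solve 1 (λ u → (u :* u :- :2) :* u :- u := u :^ 3 :- (:2 :+ :1) :* u) refl (D j x) ⟩
      D j x ^ 3 - (1# + 1# + 1#) * D j x
        ≈⟨ +-congˡ (-‿cong (trans (*-congʳ 3≈0) (zeroˡ _))) ⟩
      D j x ^ 3 - 0#
        ≈⟨ solve 1 (λ u → u :- :0 := u) refl _ ⟩
      D j x ^ 3 ∎

    D-3^ : ∀ j x → D (3 ℕ.^ j) x ≈ x ^ (3 ℕ.^ j)
    D-3^ zero    x = sym (*-identityʳ x)
    D-3^ (suc j) x = begin
      D (3 ℕ.* 3 ℕ.^ j) x     ≈⟨ D-triple (3 ℕ.^ j) x ⟩
      D (3 ℕ.^ j) x ^ 3       ≈⟨ ^-congˡ 3 (D-3^ j x) ⟩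
      (x ^ (3 ℕ.^ j)) ^ 3     ≈⟨ ^-assocʳ x (3 ℕ.^ j) 3 ⟩
      x ^ (3 ℕ.^ j ℕ.* 3)     ≈⟨ ^-congʳ x (ℕ.*-comm (3 ℕ.^ j) 3) ⟩
      x ^ (3 ℕ.* 3 ℕ.^ j)     ∎

-- Dickson permutations in characteristic 3 and the Coulter-Matthews exponents

module DicksonFiniteField {N} (F : FiniteField c ℓ N) where
  open FiniteField F hiding (zero)
  open FiniteFieldProperties F
  open Dickson commutativeRing public
  open Relation.Binary.Reasoning.Setoid setoid

  module _ (3≈0 : 1# + 1# + 1# ≈ 0#) {e l : ℕ} (N≡3^l : N ≡ 3 ℕ.^ l) (N≡1+e : N ≡ suc e) where
    open Characteristic3 3≈0

    D-order : ∀ x → D (suc e) x ≈ x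
    D-order x = trans (D-index (≡.trans (≡.sym N≡1+e) N≡3^l)) (trans (D-3^ l x)
      (trans (^-congʳ x (≡.sym N≡3^l)) (fermat x)))

    -- D (N + 1) + D (N - 1) = x ² and D (N + 1) D (N - 1) = 2 x ² - 4, so one of them is 2.
    period-dichotomy : ∀ x → Period e x ⊎ Period (suc (suc e)) x
    period-dichotomy x = [ (λ v-2≈0 → inj₁ (period (x∙y⁻¹≈ε⇒x≈y _ _ v-2≈0) (D-order x)))
                         , (λ u-2≈0 → inj₂ (upper (x∙y⁻¹≈ε⇒x≈y _ _ u-2≈0))) ]′ (integral vanishing)
      where
      u v : Carrier
      u = D (suc (suc e)) x
      v = D e x
      upper : u ≈ 1# + 1# → Period (suc (suc e)) x
      upper u≈2 = period u≈2 (trans (+-cong (*-congˡ u≈2) (-‿cong (D-order x)))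
        (solve 1 (λ x → x :* :2 :- x := x) refl x))
      u≈ : u ≈ x * x - v
      u≈ = +-congʳ (*-congˡ (D-order x))
      uv≈ : u * v ≈ (x * x - (1# + 1#)) + (x * x - (1# + 1#))
      uv≈ = begin
        u * v
          ≈⟨ D-product e {2} {t = 2 ℕ.* suc e} (ℕ.+-comm 2 e) 
               (≡.trans (≡.cong (λ i → suc (e ℕ.+ i)) (ℕ.+-identityʳ (suc e))) (≡.sym (ℕ.+-suc e (suc e)))) x ⟩
        D (2 ℕ.* suc e) x + (x * x - (1# + 1#))
          ≈⟨ +-congʳ (trans (D-double (suc e) x) (+-congʳ (*-cong (D-order x) (D-order x)))) ⟩
        (x * x - (1# + 1#)) + (x * x - (1# + 1#)) ∎
      vanishing : (v - (1# + 1#)) * (u - (1# + 1#)) ≈ 0#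
      vanishing = begin
        (v - (1# + 1#)) * (u - (1# + 1#))
          ≈⟨ solve 2 (λ u v → (v :- :2) :* (u :- :2) := u :* v :- :2 :* (u :+ v) :+ :2 :* :2) refl u v ⟩
        u * v - (1# + 1#) * (u + v) + (1# + 1#) * (1# + 1#)
          ≈⟨ +-congʳ (+-cong uv≈ (-‿cong (*-congˡ (+-congʳ u≈)))) ⟩
        (x * x - (1# + 1#)) + (x * x - (1# + 1#)) - (1# + 1#) * (x * x - v + v) + (1# + 1#) * (1# + 1#)
          ≈⟨ solve 2 (λ x v → (x :* x :- :2) :+ (x :* x :- :2) :- :2 :* (x :* x :- v :+ v) :+ :2 :* :2 := :0) refl x v ⟩
        0# ∎

    -- Which of the periods N - 1 and N + 1 occurs depends on x; their product N ² - 1 serves every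
    -- x.
    D-periodic : ∀ x j → Period (j ℕ.* (e ℕ.* suc (suc e))) x
    D-periodic x j i with period-dichotomy x
    ... | inj₁ per = trans (D-index (≡.cong (i ℕ.+_) 
                       (≡.trans (≡.cong (j ℕ.*_) (ℕ.*-comm e _)) (≡.sym (ℕ.*-assoc j (suc (suc e)) e)))))
                       (Period-* per (j ℕ.* suc (suc e)) i)
    ... | inj₂ per = trans (D-index (≡.cong (i ℕ.+_) (≡.sym (ℕ.*-assoc j e (suc (suc e))))))
                       (Period-* per (j ℕ.* e) i)

    D-injective : ∀ {m} → Coprime m (e ℕ.* suc (suc e)) → Injective _≈_ _≈_ (D m)
    D-injective {m} coprime {x} {y} eq with coprime-Bézout coprime
    ... | Bézout.+- r j bezout = trans (sym (left-inverse x)) (trans (D-cong r eq) (left-inverse y))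
      where
      left-inverse : ∀ x → D r (D m x) ≈ x
      left-inverse x = trans (D-compose r m x) (trans (D-index (≡.sym bezout)) (D-periodic x j 1))
    -- Here r m is -1 modulo the period. Running the recurrence one step backwards from the values 2
    -- and x gives 2 x - x = x, that is, D at -1 equals D at 1.
    ... | Bézout.-+ r j bezout = trans (sym (left-inverse x)) (trans (D-cong r eq) (left-inverse y))
      where
      left-inverse : ∀ x → D r (D m x) ≈ x
      left-inverse x = begin
        D r (D m x)                                   ≈⟨ D-compose r m x ⟩
        D (r ℕ.* m) x                                 ≈⟨ solve 3 (λ x u v → v := x :* u :- (x :* u :- v)) refl x (D (suc (r ℕ.* m)) x) _ ⟩
        x * D (suc (r ℕ.* m)) x - D (suc (suc (r ℕ.* m))) x
          ≈⟨ +-cong (*-congˡ (trans (D-index bezout) (D-periodic x j 0)))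
               (-‿cong (trans (D-index (≡.cong suc bezout)) (D-periodic x j 1))) ⟩
        x * (1# + 1#) - x                             ≈⟨ solve 1 (λ x → x :* :2 :- x := x) refl x ⟩
        x                                             ∎

    -- With x = y + y⁻¹ and ε = ±1 one has x + 2 ε = (y + ε)² / y, and the left-hand side becomes
    -- (y + ε)^(3^k + 1) / y^((3^k + 1) / 2), where (y + ε)^(3^k) = y^(3^k) + ε.
    shifted-power : ∀ {ε} → ε * ε ≈ 1# → ∀ k x → let m = [3^ k -1]/2 in
                    (x + (1# + 1#) * ε) ^ suc m ≈ D (suc m) x + ε * D m x
    shifted-power {ε} ε²≈1 zero    x = solve 2 (λ x ε → (x :+ :2 :* ε) :* :1 := x :+ ε :* :2) refl x ε
    shifted-power {ε} ε²≈1 (suc k) x with (x + (1# + 1#) * ε) ≟ 0#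
    -- The other case cancels X, so X = 0 is separate. Then x = - 2 ε, and each sum D (i + 1) + ε D
    -- i is - ε times the preceding one, starting from X.
    ... | yes X≈0 = trans (trans (*-congʳ X≈0) (zeroˡ _)) (sym (alternating (suc (3 ℕ.* [3^ k -1]/2))))
      where
      alternating : ∀ i → D (suc i) x + ε * D i x ≈ 0#
      alternating zero    = trans (solve 2 (λ x ε → x :+ ε :* :2 := x :+ :2 :* ε) refl x ε) X≈0
      alternating (suc i) = begin
        x * D (suc i) x - D i x + ε * D (suc i) x
          ≈⟨ solve 4 (λ x ε u v → x :* u :- v :+ ε :* u := (x :+ :2 :* ε) :* u :- ε :* u :- :1 :* v) refl x ε _ _ ⟩
        (x + (1# + 1#) * ε) * D (suc i) x - ε * D (suc i) x - 1# * D i x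
          ≈⟨ +-cong (+-congʳ (*-congʳ X≈0)) (-‿cong (*-congʳ (sym ε²≈1))) ⟩
        0# * D (suc i) x - ε * D (suc i) x - ε * ε * D i x
          ≈⟨ solve 3 (λ ε u v → :0 :* u :- ε :* u :- ε :* ε :* v := :- ε :* (u :+ ε :* v)) refl ε _ _ ⟩
        - ε * (D (suc i) x + ε * D i x)
          ≈⟨ trans (*-congˡ (alternating i)) (zeroʳ _) ⟩
        0# ∎
    -- The next exponent is 3 μ + 2, so one extra factor X makes the left side the cube of the
    -- induction hypothesis. Cubing is additive in characteristic 3 and triples Dickson indices; the
    -- recurrence then exhibits X as a factor on the right.
    ... | no X≉0 = *-cancelˡ X≉0 (begin
      X ^ suc (suc (suc (3 ℕ.* μ)))
        ≈⟨ ^-congʳ X (≡.trans (≡.sym (ℕ.*-suc 3 μ)) (ℕ.*-comm 3 (suc μ))) ⟩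
      X ^ (suc μ ℕ.* 3)
        ≈⟨ ^-assocʳ X (suc μ) 3 ⟨
      (X ^ suc μ) ^ 3
        ≈⟨ ^-congˡ 3 (shifted-power ε²≈1 k x) ⟩
      (D (suc μ) x + ε * D μ x) ^ 3
        ≈⟨ solve 3 (λ u v ε → (u :+ ε :* v) :^ 3 :=
             u :^ 3 :+ ε :* ε :* (ε :* v :^ 3) :+ (:2 :+ :1) :* (u :* u :* ε :* v :+ u :* (ε :* v) :* (ε :* v))) refl _ _ ε ⟩
      D (suc μ) x ^ 3 + ε * ε * (ε * D μ x ^ 3) + (1# + 1# + 1#) * _
        ≈⟨ +-cong (+-cong (trans (sym (D-triple (suc μ) x)) (D-index (ℕ.*-suc 3 μ)))
                          (*-cong ε²≈1 (*-congˡ (sym (D-triple μ x)))))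
             (trans (*-congʳ 3≈0) (zeroˡ _)) ⟩
      D (suc (suc (suc i))) x + 1# * (ε * D i x) + 0#
        ≈⟨ solve 4 (λ x ε a b → x :* (x :* b :- a) :- b :+ :1 :* (ε :* a) :+ :0 :=
             x :* (x :* b :- a) :+ :2 :* :1 :* b :+ ε :* (x :* b) :+ :2 :* ε :* (x :* b :- a) :-
             (:2 :+ :1) :* (b :+ ε :* (x :* b :- a))) refl x ε (D i x) (D (suc i) x) ⟩
      x * D (suc (suc i)) x + (1# + 1#) * 1# * D (suc i) x + ε * (x * D (suc i) x)
        + (1# + 1#) * ε * D (suc (suc i)) x - (1# + 1# + 1#) * (D (suc i) x + ε * D (suc (suc i)) x)
        ≈⟨ +-cong (+-congʳ (+-congʳ (+-congˡ (*-congʳ (*-congˡ (sym ε²≈1))))))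
             (-‿cong (trans (*-congʳ 3≈0) (zeroˡ _))) ⟩
      x * D (suc (suc i)) x + (1# + 1#) * (ε * ε) * D (suc i) x + ε * (x * D (suc i) x)
        + (1# + 1#) * ε * D (suc (suc i)) x - 0#
        ≈⟨ solve 4 (λ x ε b c → x :* c :+ :2 :* (ε :* ε) :* b :+ ε :* (x :* b) :+ :2 :* ε :* c :- :0 :=
             (x :+ :2 :* ε) :* (c :+ ε :* b)) refl x ε (D (suc i) x) (D (suc (suc i)) x) ⟩
      X * (D (suc (suc i)) x + ε * D (suc i) x) ∎)
      where
      μ = [3^ k -1]/2
      i = 3 ℕ.* μ
      X = x + (1# + 1#) * ε

    -- After scaling, x + a and x become X + 2 and X - 2, because 4 = 1.
    coulterMatthews : OddCharacteristic F → ∀ k → Coprime [3^ k -1]/2 (e ℕ.* suc (suc e)) →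
                      Planar F (power F (suc [3^ k -1]/2))
    coulterMatthews 2≉0 k coprime = PlanarPowers.injective⇒planar F 2≉0 (power F d) injective
      where
      μ = [3^ k -1]/2
      d = suc μ
      injective : ∀ a → ¬ a ≈ 0# → Injective _≈_ _≈_ (λ x → (x + a) ^ d - x ^ d)
      injective a a≉0 {x} {y} eq = *-cancelˡ w≉0 (trans (shift x) (trans (+-congʳ X≈Y) (sym (shift y))))
        where
        w = a ⁻¹⟨ a≉0 ⟩
        X : Carrier → Carrier
        X x = w * x + (1# + 1#)
        shift : ∀ x → w * x ≈ X x - (1# + 1#)
        shift x = solve 1 (λ u → u := u :+ :2 :- :2) refl _
        w≉0 : ¬ w ≈ 0#
        w≉0 w≈0 = 1≉0 (trans (sym (*-inverseʳ a≉0)) (trans (*-congˡ w≈0) (zeroʳ a)))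
        wa≈1 : ∀ x → a * (w * x) ≈ x
        wa≈1 x = trans (sym (*-assoc a w x)) (trans (*-congʳ (*-inverseʳ a≉0)) (*-identityˡ x))
        plus : ∀ x → x + a ≈ a * (X x + (1# + 1#) * 1#)
        plus x = sym (begin
          a * (X x + (1# + 1#) * 1#)       ≈⟨ solve 2 (λ a u → a :* (u :+ :2 :+ :2 :* :1) := a :* u :+ a :+ a :* (:2 :+ :1)) refl a _ ⟩
          a * (w * x) + a + a * (1# + 1# + 1#) ≈⟨ +-cong (+-congʳ (wa≈1 x)) (trans (*-congˡ 3≈0) (zeroʳ a)) ⟩
          x + a + 0#                       ≈⟨ +-identityʳ _ ⟩
          x + a                            ∎)
        minus : ∀ x → x ≈ a * (X x + (1# + 1#) * - 1#)
        minus x = sym (trans (*-congˡ (solve 1 (λ u → u :+ :2 :+ :2 :* :- :1 := u) refl _)) (wa≈1 x))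
        -- Subtracting the cases ε = 1 and ε = - 1 of `shifted-power` cancels `D d` and leaves twice
        -- `D μ`.
        expand : ∀ x → (x + a) ^ d - x ^ d ≈ (a ^ d * (1# + 1#)) * D μ (X x)
        expand x = begin
          (x + a) ^ d - x ^ d
            ≈⟨ +-cong (trans (^-congˡ d (plus x)) (^-distrib-* a _ d))
                 (-‿cong (trans (^-congˡ d (minus x)) (^-distrib-* a _ d))) ⟩
          a ^ d * (X x + (1# + 1#) * 1#) ^ d - a ^ d * (X x + (1# + 1#) * - 1#) ^ d
            ≈⟨ +-cong (*-congˡ (shifted-power (*-identityˡ 1#) k (X x)))
                 (-‿cong (*-congˡ (shifted-power (solve 0 (:- :1 :* :- :1 := :1) refl) k (X x)))) ⟩
          a ^ d * (D d (X x) + 1# * D μ (X x)) - a ^ d * (D d (X x) + - 1# * D μ (X x))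
            ≈⟨ solve 3 (λ A u v → A :* (u :+ :1 :* v) :- A :* (u :+ :- :1 :* v) := (A :* :2) :* v) refl _ _ _ ⟩
          (a ^ d * (1# + 1#)) * D μ (X x) ∎
        X≈Y : X x ≈ X y
        X≈Y = D-injective coprime (*-cancelˡ (*-≉0 (λ eq → a≉0 (^≈0⇒≈0 d eq)) 2≉0)
          (trans (sym (expand x)) (trans eq (expand y))))

-- The families of exponents and the final assembly

open import Data.Nat.Base using (_+_; _*_; _^_; _≤_)

-- Odd squares are 1 modulo 4. For even k this makes (p ^ k + 1) / 2 odd.
suc-double^even : ∀ j k → ∃ λ i → suc (j * 2) ^ (k * 2) ≡ suc (i * 4)
suc-double^even j k = proj₁ one , (begin
  suc (j * 2) ^ (k * 2)    ≡⟨ ≡.cong (suc (j * 2) ^_) (ℕ.*-comm k 2) ⟩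
  suc (j * 2) ^ (2 * k)    ≡⟨ ℕ.^-*-assoc (suc (j * 2)) 2 k ⟨
  (suc (j * 2) ^ 2) ^ k    ≡⟨ proj₂ one ⟩
  suc (proj₁ one * 4)    ∎)
  where
  open ≡.≡-Reasoning
  open +-*-Solver
  one : OneMod 4 ((suc (j * 2) ^ 2) ^ k)
  one = OneMod-^ 4 (j + j * j ,
    solve 1 (λ j → (con 1 :+ j :* con 2) :* ((con 1 :+ j :* con 2) :* con 1) := con 1 :+ (j :+ j :* j) :* con 4) ≡.refl j) k

suc-quadruple+1 : ∀ i → suc (i * 4) + 1 ≡ suc (i * 2) + suc (i * 2)
suc-quadruple+1 = solve 1 (λ i → con 1 :+ i :* con 4 :+ con 1 := (con 1 :+ i :* con 2) :+ (con 1 :+ i :* con 2)) ≡.refl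
  where open +-*-Solver

module _ {a b c ℓ : Level} (p n : ℕ) (isPrime : Prime p) (2∤p : ¬ 2 ∣ p)
         (K : FiniteField a b (p ^ n)) (L : FiniteField c ℓ ((p ^ n) ^ 2)) (emb : Embedding K L)
         (θ : FiniteField.Carrier L)
         (nonsquare : NonsquareInSubfield emb (FiniteField._^_ L θ (p ^ n + 1))) where
  private
    q = p ^ n
    module L = FiniteField L
    module LP = FiniteFieldProperties L

    p⋆1≈0 : p LP.⋆ L.1# L.≈ L.0#
    p⋆1≈0 = LP.p⋆1≈0 (n * 2) (ℕ.^-*-assoc p n 2)

    2≉0 : OddCharacteristic L
    2≉0 = LP.odd⇒2≉0 2∤p p⋆1≈0

  open PlanarPowers L 2≉0

  fibresLikeSquaring⇒unital : (f : Fun L) → FibresLikeSquaring L f → IsUnital L q f (𝒰 emb θ)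
  fibresLikeSquaring⇒unital f fibres with G , f≈G² ← fibresLikeSquaring⇒square L f fibres =
    QuadraticExtension.unital p n isPrime 2∤p K L emb θ nonsquare f G f≈G²

  planar⇒unital : ∀ {d} j → let e = suc (j * 2) in d ≡ e + e → Planar L (power L d) →
                  Planar L (power L d) × IsUnital L q (power L d) (𝒰 emb θ)
  planar⇒unital {d} j d≡e+e planar with G , f≈G² ← planar⇒square j d≡e+e planar =
    planar , QuadraticExtension.unital p n isPrime 2∤p K L emb θ nonsquare (power L d) G f≈G²

  -- Oddness of m is used twice: it makes g and hence k even, so that the exponent is twice an odd
  -- number, and since 2 n divides k m, it is an odd number of iterations of the p ^ k power map
  -- that gives the identity on L.
  power[p^k+1] : ∀ {k m g} → ¬ 2 ∣ m → 2 * n ≡ m * g → g ∣ k →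
                 Planar L (power L (p ^ k + 1)) × IsUnital L q (power L (p ^ k + 1)) (𝒰 emb θ)
  power[p^k+1] {k} {m} {g} 2∤m 2n≡mg (divides k′ k≡k′g)
    with j , p≡ ← odd⇒suc-double p 2∤p | i , m≡ ← odd⇒suc-double m 2∤m =
    planar⇒unital (proj₁ 1mod4) d≡e+e (FrobeniusPlanar.power[Q+1]-planar (p ^ k)
      (LP.Frobenius.frobenius^-+ p isPrime p⋆1≈0 k) (proj₁ odd)
      (≡.trans (≡.cong (_^ k) p≡) (proj₂ odd)) i periodic)
    where
    odd = OneMod-^ 2 (j , ≡.refl) k
    2∣g : 2 ∣ g
    2∣g = [ (λ 2∣m → contradiction 2∣m 2∤m) , (λ 2∣g → 2∣g) ]′
      (euclidsLemma m g prime[2] (≡.subst (2 ∣_) 2n≡mg (m∣m*n n)))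
    k/2 = k′ * quotient 2∣g
    1mod4 = suc-double^even j k/2
    k≡ : k ≡ k/2 * 2
    k≡ = ≡.trans k≡k′g (≡.trans (≡.cong (k′ *_) (_∣_.equality 2∣g)) (≡.sym (ℕ.*-assoc k′ _ 2)))
    d≡e+e : p ^ k + 1 ≡ suc (proj₁ 1mod4 * 2) + suc (proj₁ 1mod4 * 2)
    d≡e+e = ≡.trans (≡.cong (_+ 1) (≡.trans (≡.cong₂ _^_ p≡ k≡) (proj₂ 1mod4))) (suc-quadruple+1 (proj₁ 1mod4))
    km≡2nk′ : k * m ≡ n * 2 * k′
    km≡2nk′ = begin
      k * m         ≡⟨ ≡.cong (_* m) k≡k′g ⟩
      k′ * g * m    ≡⟨ solve 3 (λ k g m → k :* g :* m := k :* (m :* g)) ≡.refl k′ g m ⟩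
      k′ * (m * g)  ≡⟨ ≡.cong (k′ *_) 2n≡mg ⟨
      k′ * (2 * n)  ≡⟨ solve 2 (λ k n → k :* (con 2 :* n) := n :* con 2 :* k) ≡.refl k′ n ⟩
      n * 2 * k′    ∎
      where
      open ≡.≡-Reasoning
      open +-*-Solver
    periodic : ∀ z → z L.^ ((p ^ k) ^ suc (i * 2)) L.≈ z
    periodic z = L.trans (LP.^-congʳ z (begin
      (p ^ k) ^ suc (i * 2)     ≡⟨ ≡.cong ((p ^ k) ^_) m≡ ⟨
      (p ^ k) ^ m               ≡⟨ ℕ.^-*-assoc p k m ⟩
      p ^ (k * m)               ≡⟨ ≡.cong (p ^_) km≡2nk′ ⟩
      p ^ (n * 2 * k′)          ≡⟨ ℕ.^-*-assoc p (n * 2) k′ ⟨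
      (p ^ (n * 2)) ^ k′        ≡⟨ ≡.cong (_^ k′) (ℕ.^-*-assoc p n 2) ⟨
      ((p ^ n) ^ 2) ^ k′        ∎)) (LP.fermat^ k′ z)
      where open ≡.≡-Reasoning

  power[[3^k+1]/2] : ∀ k → p ≡ 3 → gcd k (2 * n) ≡ 1 →
                     Planar L (power L ((3 ^ k + 1) / 2)) × IsUnital L q (power L ((3 ^ k + 1) / 2)) (𝒰 emb θ)
  power[[3^k+1]/2] k p≡3 gcd≡1
    with j , k≡ ← odd⇒suc-double k (λ 2∣k → contradiction (gcd≡1⇒coprime gcd≡1 (2∣k , m∣m*n n)) λ ())
    = ≡.subst (λ d → Planar L (power L d) × IsUnital L q (power L d) (𝒰 emb θ)) (≡.sym d≡)
        (planar⇒unital (proj₁ s) (≡.trans (≡.cong suc (≡.trans (≡.cong [3^_-1]/2 k≡) (proj₂ s)))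
            (≡.trans (ℕ.+-comm 1 _) (suc-quadruple+1 (proj₁ s))))
          (DicksonFiniteField.coulterMatthews L 3≈0 {e} {n * 2} order≡3^l order≡1+e 2≉0 k
            (coprime-[3^k-1]/2 {l = 2 * n * 2} {j} (coprime-double {l = n} (gcd≡1⇒coprime gcd≡1)) k≡ 3^l≡1+t)))
    where
    order = (p ^ n) ^ 2
    s = [3^odd-1]/2≡1+4s j
    e = ℕ.pred order
    order≡1+e : order ≡ suc e
    order≡1+e = ≡.sym (ℕ.suc-pred order {{ℕ.>-nonZero (ℕ.≤-trans (ℕ.s≤s ℕ.z≤n) LP.2≤order)}})
    order≡3^l : order ≡ 3 ^ (n * 2)
    order≡3^l = ≡.trans (≡.cong (λ p → (p ^ n) ^ 2) p≡3) (ℕ.^-*-assoc 3 n 2)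
    3^l≡1+t : 3 ^ (2 * n * 2) ≡ suc (e * suc (suc e))
    3^l≡1+t = begin
      3 ^ (2 * n * 2)          ≡⟨ ℕ.^-*-assoc 3 (2 * n) 2 ⟨
      (3 ^ (2 * n)) ^ 2        ≡⟨ ≡.cong (λ l → (3 ^ l) ^ 2) (ℕ.*-comm 2 n) ⟩
      (3 ^ (n * 2)) ^ 2        ≡⟨ ≡.cong (_^ 2) (≡.trans (≡.sym order≡3^l) order≡1+e) ⟩
      suc e ^ 2                ≡⟨ solve 1 (λ e → (con 1 :+ e) :* ((con 1 :+ e) :* con 1) := con 1 :+ e :* (con 2 :+ e)) ≡.refl e ⟩
      suc (e * suc (suc e))    ∎
      where
      open ≡.≡-Reasoning
      open +-*-Solver
    3≈0 : L.1# L.+ L.1# L.+ L.1# L.≈ L.0#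
    3≈0 = L.trans (LP.solve 0 (LP.:1 LP.:+ LP.:1 LP.:+ LP.:1 LP.:= LP.:1 LP.:+ (LP.:1 LP.:+ (LP.:1 LP.:+ LP.:0))) L.refl)
      (≡.subst (λ p → p LP.⋆ L.1# L.≈ L.0#) p≡3 p⋆1≈0)
    d≡ : (3 ^ k + 1) / 2 ≡ suc [3^ k -1]/2
    d≡ = ≡.trans (≡.cong (λ u → (u + 1) / 2) (3^≡1+2m k))
      (≡.trans (≡.cong (_/ 2) (ℕ.+-comm (suc ([3^ k -1]/2 * 2)) 1)) (m*n/n≡m (suc [3^ k -1]/2) 2))

theorem2p4 : {a b c ℓ : Level} (p n : ℕ) → Prime p → ¬ (2 ∣ p) → 1 ≤ n →
    (K : FiniteField a b (p ^ n)) (L : FiniteField c ℓ ((p ^ n) ^ 2)) (emb : Embedding K L) →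
    let q = p ^ n
        module L = FiniteField L
    in (θ : L.Carrier) → ¬ (θ L.≈ L.0#) → NonsquareInSubfield emb (θ L.^ (q + 1)) →
       ((f : Fun L) → Planar L f → FibresLikeSquaring L f → IsUnital L q f (𝒰 emb θ))
       × (Planar L (power L 2) × IsUnital L q (power L 2) (𝒰 emb θ))
       × ((k : ℕ) → 1 ≤ k → k ≤ n → ¬ (2 ∣ quotient (gcd[m,n]∣m (2 * n) k)) →
            Planar L (power L (p ^ k + 1)) × IsUnital L q (power L (p ^ k + 1)) (𝒰 emb θ))
       × ((k : ℕ) → p ≡ 3 → gcd k (2 * n) ≡ 1 →
            Planar L (power L ((3 ^ k + 1) / 2)) × IsUnital L q (power L ((3 ^ k + 1) / 2)) (𝒰 emb θ))
theorem2p4 p n isPrime 2∤p _ K L emb θ _ nonsquare =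
    (λ f _ → fibresLikeSquaring⇒unital p n isPrime 2∤p K L emb θ nonsquare f)
  -- Squaring is the case k = 0, with gcd (2 n , 0) = 2 n and odd quotient 1.
  , power[p^k+1] p n isPrime 2∤p K L emb θ nonsquare {0} {1} {2 * n}
      (2∤1+2n 0) (≡.sym (ℕ.*-identityˡ (2 * n))) ((2 * n) ∣0)
  , (λ k _ _ 2∤m → power[p^k+1] p n isPrime 2∤p K L emb θ nonsquare 2∤m
      (_∣_.equality (gcd[m,n]∣m (2 * n) k)) (gcd[m,n]∣n (2 * n) k))
  , power[[3^k+1]/2] p n isPrime 2∤p K L emb θ nonsquare
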